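{- Let $L,M$ be nonnegative integers and let $(a,b)$ be a pair of coprime integers with $1\leq b<a$. Then \[ \sum_{j\in\mathbb{Z}}(-1)^j q^{\frac{1}{2}j((2ab+1)j+1)}\mathcal{B}(L,M,aj,bj)=F_{a,b}(L,M), \] where $F_{a,b}(L,M)$ is defined below (for either choice of continued fraction representation).
   Context: Notation: $(x)_n=(x;q)_n=\prod_{i=0}^{n-1}(1-xq^i)$ for $n\in\mathbb{Z}_{\geq0}$; $\left[{n\atop m}\right]=\frac{(q)_n}{(q)_m(q)_{n-m}}$ if $m,n-m\in\mathbb{Z}_{\geq 0}$ and $0$ otherwise. Define $\mathcal{B}(L,M,a,b)=\left[{L+M+a-b\atop L+a}\right]\left[{L+M-a+b\atop L-a}\right]$. Continued fraction data: with $\mathrm{sign}(0)=0$, write $(a/b-1)^{\mathrm{sign}(a-2b)}=[a_0,\dots,a_n]=a_0+\cfrac{1}{a_1+\cfrac{1}{\cdots+\cfrac{1}{a_n}}}$ with $n\geq 0$ and positive integers $a_i$ (for $(a,b)\neq(2,1)$ there are two such representations, one with $a_n\geq 2$ and one with $a_n=1$; for $(a,b)=(2,1)$ it is $[1]$). Put $t_0=0$, $t_j=a_0+\cdots+a_{j-1}$ ($1\leq j\leq n+1$), and $d=d(a,b)=t_{n+1}$. Let $\mathcal{I}$ be the $d\times d$ matrix with $\mathcal{I}_{j,k}=\delta_{j,k+1}+\delta_{j,k-1}$ if $j\notin\{t_1,\dots,t_{n+1}\}$ and $\mathcal{I}_{j,k}=\delta_{j,k+1}+\delta_{j,k}-\delta_{j,k-1}$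 if $j\in\{t_1,\dots,t_{n+1}\}$, and let $C=C(a,b)=2I-\mathcal{I}$. For $m=(m_1,\dots,m_d)\in\mathbb{Z}_{\geq 0}^d$ write $mCm=\sum_{j,k=1}^d m_jC_{j,k}m_k$, set $\tau_1=\dots=\tau_{d-1}=2$, $\tau_d=1$, and $n_j=L\delta_{j,1}-\sum_{k=1}^d C_{j,k}m_k$ for $1\leq j\leq d$. Define, for $a\leq 2b$, \[F_{a,b}(L,M)=\sum_{m\in\mathbb{Z}_{\geq0}^{d}}q^{mCm}\left[{2L+M-m_1\atop 2L}\right]\prod_{j=1}^{d}\left[{\tau_j m_j+n_j\atop \tau_j m_j}\right],\] and, for $a\geq 2b$, \[F_{a,b}(L,M)=\sum_{m\in\mathbb{Z}_{\geq0}^{d}}q^{L(L-2m_1)+mCm}\left[{L+M+m_1\atop 2L}\right]\prod_{j=1}^{d}\left[{\tau_j m_j+n_j\atop \tau_j m_j}\right]\] (the two definitions agree for $(a,b)=(2,1)$). -}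

module Defs where

open import Data.Bool using (Bool; true; false; if_then_else_; _∧_)
open import Data.Nat as ℕ using (ℕ; zero; suc)
open import Data.Integer as ℤ using (ℤ; +_; -[1+_]; ∣_∣; _/ℕ_)
open import Data.Fin using (Fin; toℕ)
open import Data.Vec as Vec using (Vec; []; _∷_; lookup)
open import Data.List as List using (List; []; _∷_; upTo; map; concat; concatMap; foldr; allFin; scanl)
open import Data.Nat.ListAction using (sum)
open import Data.Bool.ListAction using (any)
open import Data.List.NonEmpty as List⁺ using (List⁺; _∷_; toList)
open import Data.Product using (_×_; _,_; proj₁; proj₂)
open import Relation.Nullary.Decidable using (does)

-- Laurent polynomials in q with integer coefficients, represented as
-- finite lists of monomials (coefficient , exponent).

Poly : Set
Poly = List (ℤ × ℤ)

mono : ℤ → ℤ → Poly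
mono c e = (c , e) ∷ []

zeroP : Poly
zeroP = []

oneP : Poly
oneP = mono (+ 1) (+ 0)

infixl 6 _⊕_
infixl 7 _⊗_

_⊕_ : Poly → Poly → Poly
p ⊕ r = p List.++ r

_⊗_ : Poly → Poly → Poly
p ⊗ r = concatMap (λ ce → map (λ ce' → (proj₁ ce ℤ.* proj₁ ce' , proj₂ ce ℤ.+ proj₂ ce')) r) p

coeff : Poly → ℤ → ℤ
coeff [] k = + 0
coeff ((c , e) ∷ p) k = if does (e ℤ.≟ k) then c ℤ.+ coeff p k else coeff p k

sumP : List Poly → Poly
sumP = concat

prodP : List Poly → Poly
prodP = foldr _⊗_ oneP

-- Gaussian binomial coefficients [n over m] (polynomials in q), via the
-- q-Pascal rule [n+1, m+1] = [n, m] + q^(m+1) [n, m+1].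

qbinℕ : ℕ → ℕ → Poly
qbinℕ n zero = oneP
qbinℕ zero (suc m) = zeroP
qbinℕ (suc n) (suc m) = qbinℕ n m ⊕ (mono (+ 1) (+ suc m) ⊗ qbinℕ n (suc m))

qbin : ℤ → ℤ → Poly
qbin n m = if (+ 0 ℤ.≤ᵇ m) ∧ (m ℤ.≤ᵇ n) then qbinℕ ∣ n ∣ ∣ m ∣ else zeroP

𝓑 : ℤ → ℤ → ℤ → ℤ → Poly
𝓑 L M a b = qbin (L ℤ.+ M ℤ.+ a ℤ.- b) (L ℤ.+ a) ⊗ qbin (L ℤ.+ M ℤ.- a ℤ.+ b) (L ℤ.- a)

intRange : ℕ → List ℤ
intRange R = map (λ i → + i ℤ.- + R) (upTo (suc (2 ℕ.* R)))

lhsTerm : ℕ → ℕ → ℕ → ℕ → ℤ → Poly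
lhsTerm a b L M j =
  mono (ℤ.-1ℤ ℤ.^ ∣ j ∣)
       ((j ℤ.* (+ (2 ℕ.* a ℕ.* b ℕ.+ 1) ℤ.* j ℤ.+ + 1)) /ℕ 2)
  ⊗ 𝓑 (+ L) (+ M) (+ a ℤ.* j) (+ b ℤ.* j)

lhsPartial : ℕ → ℕ → ℕ → ℕ → ℕ → Poly
lhsPartial a b L M R = sumP (map (lhsTerm a b L M) (intRange R))

-- Continued fractions [a_0, ..., a_n], value as (numerator , denominator).

cfVal′ : ℕ → List ℕ → ℕ × ℕ
cfVal′ a0 [] = (a0 , 1)
cfVal′ a0 (a1 ∷ rest) with cfVal′ a1 rest
... | (p , r) = (a0 ℕ.* p ℕ.+ r , p)

cfVal : List⁺ ℕ → ℕ × ℕ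
cfVal (a0 ∷ rest) = cfVal′ a0 rest

-- (a/b - 1)^{sign(a-2b)} as (numerator , denominator)  (for b < a)
cfTarget : ℕ → ℕ → ℕ × ℕ
cfTarget a b =
  if a ℕ.<ᵇ 2 ℕ.* b then (b , a ℕ.∸ b)
  else if 2 ℕ.* b ℕ.<ᵇ a then (a ℕ.∸ b , b)
  else (1 , 1)

IsCFOf : List⁺ ℕ → ℕ × ℕ → Set
IsCFOf cf (x , y) = proj₁ (cfVal cf) ℕ.* y ≡ x ℕ.* proj₂ (cfVal cf)
  where open import Relation.Binary.PropositionalEquality using (_≡_)

dim : List⁺ ℕ → ℕ
dim cf = sum (toList cf)

tSet : List⁺ ℕ → List ℕ
tSet cf = List.drop 1 (scanl ℕ._+_ 0 (toList cf))

inT : List⁺ ℕ → ℕ → Bool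
inT cf j = any (λ t → t ℕ.≡ᵇ j) (tSet cf)

δ : ℕ → ℕ → ℤ
δ j k = if j ℕ.≡ᵇ k then + 1 else + 0

-- incidence matrix 𝓘 (indices 1..d)
𝓘 : List⁺ ℕ → ℕ → ℕ → ℤ
𝓘 cf j k =
  if inT cf j
  then δ j (suc k) ℤ.+ δ j k ℤ.- δ (suc j) k
  else δ j (suc k) ℤ.+ δ (suc j) k

Cmat : List⁺ ℕ → ℕ → ℕ → ℤ
Cmat cf j k = + 2 ℤ.* δ j k ℤ.- 𝓘 cf j k

sumℤ : List ℤ → ℤ
sumℤ = foldr ℤ._+_ (+ 0)

module _ (cf : List⁺ ℕ) (m : Vec ℕ (dim cf)) where
  ix : Fin (dim cf) → ℕ
  ix i = suc (toℕ i)

  mv : Fin (dim cf) → ℤ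
  mv i = + lookup m i

  mCm : ℤ
  mCm = sumℤ (map (λ i → sumℤ (map (λ k → mv i ℤ.* Cmat cf (ix i) (ix k) ℤ.* mv k) (allFin _))) (allFin _))

  nj : ℕ → Fin (dim cf) → ℤ
  nj L i = + L ℤ.* δ (ix i) 1 ℤ.- sumℤ (map (λ k → Cmat cf (ix i) (ix k) ℤ.* mv k) (allFin _))

  τ : Fin (dim cf) → ℤ
  τ i = if ix i ℕ.≡ᵇ dim cf then + 1 else + 2

  prodTerm : ℕ → Poly
  prodTerm L = prodP (map (λ i → qbin (τ i ℤ.* mv i ℤ.+ nj L i) (τ i ℤ.* mv i)) (allFin _))

-- m_1 (d ≥ 1 in all cases considered)
first : ∀ {n} → Vec ℕ n → ℕ
first [] = 0
first (x ∷ _) = x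

box : (d R : ℕ) → List (Vec ℕ d)
box zero R = [] ∷ []
box (suc d) R = concatMap (λ x → map (x ∷_) (box d R)) (upTo (suc R))

-- partial sum of F_{a,b}(L,M) over m ∈ {0..R}^d, case a ≤ 2b
Fle-partial : List⁺ ℕ → ℕ → ℕ → ℕ → Poly
Fle-partial cf L M R = sumP (map term (box (dim cf) R))
  where
  term : Vec ℕ (dim cf) → Poly
  term m = mono (+ 1) (mCm cf m)
           ⊗ qbin (+ (2 ℕ.* L ℕ.+ M) ℤ.- + first m) (+ (2 ℕ.* L))
           ⊗ prodTerm cf m L

-- partial sum of F_{a,b}(L,M) over m ∈ {0..R}^d, case a ≥ 2b
Fge-partial : List⁺ ℕ → ℕ → ℕ → ℕ → Poly
Fge-partial cf L M R = sumP (map term (box (dim cf) R))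
  where
  term : Vec ℕ (dim cf) → Poly
  term m = mono (+ 1) (+ L ℤ.* (+ L ℤ.- + (2 ℕ.* first m)) ℤ.+ mCm cf m)
           ⊗ qbin (+ (L ℕ.+ M ℕ.+ first m)) (+ (2 ℕ.* L))
           ⊗ prodTerm cf m L

-- Equality of two formal (Laurent) series given as limits of partial sums:
-- for every exponent k the k-th coefficients of both partial-sum
-- sequences are eventually constant, with the same eventual value.
SameLimit : (ℕ → Poly) → (ℕ → Poly) → Set
SameLimit S T = ∀ k → ∃[ v ] ∃[ N ] (∀ R → N ℕ.≤ R → (coeff (S R) k ≡ v) × (coeff (T R) k ≡ v))
  where
  open import Data.Product using (∃-syntax)
  open import Relation.Binary.PropositionalEquality using (_≡_)

{-# OPTIONS --safe #-}
module Submission where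

-- Write S(a,b;L,M) for the left-hand side. The Burge transform, a form of the q-Saalschütz sum,
-- says that for a, b of the same sign
--   Σ_i q^(i²) [2L+M-i; 2L] B(L-i, i, a, b) = q^(b²) B(L, M, a+b, b),
-- so it sends S(a,b) to S(a+b,b); combined with the symmetry B(L,M,a,b) = B(M,L,b,a) it also sends
-- S(a,b) to S(a+b,a). Starting from S(1,1;L,M) = [L+M; L], the continued fraction spells out the
-- sequence of these two moves that leads to (a,b), one move for each summation variable m_j: after
-- m_1, ..., m_j have been chosen the pair (L,M) has become (m_j, m_(j-1) - m_j), with m_0 = L. The
-- incidence matrix records the moves: for j < d, row j lies in T exactly when the
-- (j+1)-st move is (a,b) ↦ (a+b,a).

open import Defs
open import Algebra.Bundles using (CommutativeRing)
import Algebra.Properties.Ring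
import Algebra.Properties.Semiring.Sum
import Algebra.Solver.Ring.NaturalCoefficients.Default
open import Data.Bool as Bool using (Bool; true; false; if_then_else_; _∨_)
open import Data.Fin as Fin using (Fin; toℕ)
import Data.Fin.Properties as Finₚ
open import Data.Integer as ℤ using (ℤ; +_; -[1+_])
import Data.Integer.DivMod as ℤ÷
import Data.Integer.Properties as ℤₚ
import Data.Integer.Tactic.RingSolver as ℤS
open import Data.List as List using (List; []; _∷_; _++_; map; allFin; upTo; applyUpTo; concatMap)
import Data.List.Properties as Listₚ
open import Data.List.NonEmpty using (List⁺; _∷_; toList)
open import Data.List.Relation.Unary.All using (All; []; _∷_)
open import Data.Nat as ℕ using (ℕ; zero; suc; z≤n; s≤s)
open import Data.Nat.Coprimality using (Coprime; coprime-divisor; 1-coprimeTo) renaming (sym to coprime-sym)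
open import Data.Nat.Divisibility using (_∣_; divides; ∣m+n∣m⇒∣n; ∣m∣n⇒∣m+n; ∣-antisym; n∣m*n; ∣-refl; ∣n⇒∣m*n)
import Data.Nat.Properties as ℕₚ
import Data.Nat.Tactic.RingSolver as ℕS
open import Data.Product using (_×_; _,_; proj₁; proj₂; ∃)
open import Data.Vec using (Vec; []; _∷_; lookup)
open import Function using (_∘_; id)
open import Level using (Level; 0ℓ; _⊔_)
import Relation.Binary.Reasoning.Setoid
open import Relation.Binary.PropositionalEquality as ≡ using (_≡_; cong; cong₂; subst)
open import Relation.Nullary using (¬_; yes; no)
open import Relation.Nullary.Decidable using (does; dec-true; dec-false)
open import Relation.Nullary.Negation using (contradiction)

-- Continued fractions

-- The exponent of q is ab j² + j(j+1)/2. A move changes only its quadratic part, since ab + b² =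
-- (a+b) b, so one evaluation at (1,1) supports the whole family. It rests on expanding B(L,M,j,j)
-- in the binomials [2r; r+j], whose alternating sum over j vanishes for r > 0. The first move
-- belongs to no row of the matrix. It is fixed by comparing a with 2b: undoing it leads to (b, a-b)
-- or (a-b, b), which is why F has two forms and why the continued fraction is that of a/b - 1 or of
-- its inverse. At the other end, the two representations of the fraction differ only in the
-- innermost move, and this one acts on (1,1), where both moves give (2,1). Both sides are finite
-- sums; eventual constancy comes from an equality that holds for all cut-offs at least L.

-- The true move is a Burge step on the swapped pair (b,a), hence the order `b + a`.
stepPair : Bool → ℕ × ℕ → ℕ × ℕ
stepPair true  (a , b) = (b ℕ.+ a , a)
stepPair false (a , b) = (a ℕ.+ b , b)

-- Moves are read from the outside in: `β 0` is the last one to be applied.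
pairOf : (ℕ → Bool) → ℕ → ℕ × ℕ
pairOf β zero    = (1 , 1)
pairOf β (suc d) = stepPair (β 0) (pairOf (β ∘ suc) d)

pairOf-cong : ∀ {β γ} d → (∀ j → β j ≡ γ j) → pairOf β d ≡ pairOf γ d
pairOf-cong zero    h = ≡.refl
pairOf-cong (suc d) h = cong₂ stepPair (h 0) (pairOf-cong d (h ∘ suc))

-- A run of false moves adds b to the first entry once per move; such runs produce the partial
-- quotients.
pairOf-run : ∀ {β a b} k d → (∀ j → j ℕ.< k → β j ≡ false) → pairOf (λ j → β (k ℕ.+ j)) d ≡ (a , b) →
  pairOf β (k ℕ.+ d) ≡ (k ℕ.* b ℕ.+ a , b)
pairOf-run zero    d h eq = eq
pairOf-run {β} {a} {b} (suc k) d h eq rewrite h 0 (s≤s z≤n) | pairOf-run {β ∘ suc} k d (λ j j<k → h (suc j) (s≤s j<k)) eq =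
  cong (_, b) (≡.trans (ℕₚ.+-comm (k ℕ.* b ℕ.+ a) b) (≡.sym (ℕₚ.+-assoc b (k ℕ.* b) a)))

≡ᵇ-refl : ∀ n → (n ℕ.≡ᵇ n) ≡ true
≡ᵇ-refl zero    = ≡.refl
≡ᵇ-refl (suc n) = ≡ᵇ-refl n

+-≡ᵇ-cancelˡ : ∀ c m n → (c ℕ.+ m ℕ.≡ᵇ c ℕ.+ n) ≡ (m ℕ.≡ᵇ n)
+-≡ᵇ-cancelˡ zero    m n = ≡.refl
+-≡ᵇ-cancelˡ (suc c) m n = +-≡ᵇ-cancelˡ c m n

<⇒≢ᵇ : ∀ {m n} → m ℕ.< n → (n ℕ.≡ᵇ m) ≡ false
<⇒≢ᵇ {zero}  (s≤s p) = ≡.refl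
<⇒≢ᵇ {suc m} (s≤s p) = <⇒≢ᵇ p

inT-head : ∀ s xs → inT (s ∷ xs) s ≡ true
inT-head s []       rewrite ≡ᵇ-refl s = ≡.refl
inT-head s (x ∷ xs) rewrite ≡ᵇ-refl s = ≡.refl

inT-below : ∀ s xs {j} → j ℕ.< s → inT (s ∷ xs) j ≡ false
inT-below s []       j<s rewrite <⇒≢ᵇ j<s = ≡.refl
inT-below s (x ∷ xs) j<s rewrite <⇒≢ᵇ j<s = inT-below (s ℕ.+ x) xs (ℕₚ.<-≤-trans j<s (ℕₚ.m≤m+n s x))

-- The first entry enters every partial sum, so raising it by c moves all of T by c.
inT-shift : ∀ c s xs j → inT (c ℕ.+ s ∷ xs) (c ℕ.+ j) ≡ inT (s ∷ xs) j
inT-shift c s []       j rewrite +-≡ᵇ-cancelˡ c s j = ≡.refl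
inT-shift c s (x ∷ xs) j rewrite +-≡ᵇ-cancelˡ c s j | ℕₚ.+-assoc c s x = cong ((s ℕ.≡ᵇ j) ∨_) (inT-shift c (s ℕ.+ x) xs j)

+-≡ᵇ-sucʳ : ∀ s j → (s ℕ.≡ᵇ s ℕ.+ suc j) ≡ false
+-≡ᵇ-sucʳ zero    j = ≡.refl
+-≡ᵇ-sucʳ (suc s) j = +-≡ᵇ-sucʳ s j

inT-tail : ∀ s x xs j → inT (s ∷ x ∷ xs) (s ℕ.+ suc j) ≡ inT (x ∷ xs) (suc j)
inT-tail s x xs j rewrite +-≡ᵇ-sucʳ s j = inT-shift s x xs (suc j)

-- This fixes the form of the last row of C. Positivity makes the `dim` of the tail a successor, as
-- `inT-tail` requires.
inT-dim : ∀ cf → All (1 ℕ.≤_) (toList cf) → inT cf (dim cf) ≡ true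
inT-dim (s ∷ [])         _          rewrite ℕₚ.+-identityʳ s = inT-head s []
inT-dim (s ∷ zero ∷ xs)  (_ ∷ () ∷ _)
inT-dim (s ∷ suc x ∷ xs) (_ ∷ pos) = ≡.trans (inT-tail s (suc x) xs _) (inT-dim (suc x ∷ xs) pos)

-- Index j ≥ 1 holds the (j+1)-st move, read from row j; index 0 holds the first move, on which the
-- rows say nothing.
bits : Bool → List⁺ ℕ → ℕ → Bool
bits t cf zero    = t
bits t cf (suc j) = inT cf (suc j)

-- Let the tail have value p/r. Its moves, headed by the true one at index t₁, lead to (r + p, p).
-- The a₀ - 1 false moves outside it add p each time, which gives (a₀ p + r, p), the pair of the
-- whole fraction; `t` is applied last.
pairOf-bits : ∀ t cf → All (1 ℕ.≤_) (toList cf) → pairOf (bits t cf) (dim cf) ≡ stepPair t (cfVal cf)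
pairOf-bits t (suc a ∷ [])     (_ ∷ _)   = cong (stepPair t)
  (≡.trans (pairOf-run {a = 1} {1} a 0 (λ j j<a → inT-below (suc a) [] (s≤s j<a)) ≡.refl)
    (cong (_, 1) (≡.trans (ℕₚ.+-comm (a ℕ.* 1) 1) (cong suc (ℕₚ.*-identityʳ a)))))
pairOf-bits t (suc a ∷ x ∷ xs) (_ ∷ pos) = cong (stepPair t)
  (≡.trans (pairOf-run {a = r ℕ.+ p} {p} a (dim cf) (λ j j<a → inT-below (suc a) (x ∷ xs) (s≤s j<a))
             (≡.trans (pairOf-cong (dim cf) tail-bits) (pairOf-bits true cf pos)))
    (cong (_, p) (rearrange a p r)))
  where
  cf = x ∷ xs
  p = proj₁ (cfVal cf)
  r = proj₂ (cfVal cf)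
  tail-bits : ∀ j → inT (suc a ∷ x ∷ xs) (suc (a ℕ.+ j)) ≡ bits true cf j
  tail-bits zero    rewrite ℕₚ.+-identityʳ a = inT-head (suc a) (x ∷ xs)
  tail-bits (suc j) = inT-tail (suc a) x xs j
  rearrange : ∀ a p r → a ℕ.* p ℕ.+ (r ℕ.+ p) ≡ suc a ℕ.* p ℕ.+ r
  rearrange = ℕS.solve-∀

cfVal-coprime : ∀ s xs → Coprime (proj₁ (cfVal (s ∷ xs))) (proj₂ (cfVal (s ∷ xs)))
cfVal-coprime s []       = coprime-sym (1-coprimeTo s)
cfVal-coprime s (x ∷ xs) {i} (i∣n , i∣p) = cfVal-coprime x xs (i∣p , ∣m+n∣m⇒∣n i∣n (∣n⇒∣m*n s i∣p))

-- `IsCFOf` compares cross products only. In lowest terms this determines the pair, because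
-- corresponding entries divide each other.
coprime-fraction-unique : ∀ {p r x y} → Coprime p r → Coprime x y → p ℕ.* y ≡ x ℕ.* r → (p , r) ≡ (x , y)
coprime-fraction-unique {p} {r} {x} {y} p⊥r x⊥y eq = cong₂ _,_
  (∣-antisym (coprime-divisor p⊥r (divides y (≡.trans (ℕₚ.*-comm r x) (≡.trans (≡.sym eq) (ℕₚ.*-comm p y)))))
             (coprime-divisor x⊥y (divides r (≡.trans (ℕₚ.*-comm y p) (≡.trans eq (ℕₚ.*-comm x r))))))
  (∣-antisym (coprime-divisor (coprime-sym p⊥r) (divides x eq))
             (coprime-divisor (coprime-sym x⊥y) (divides p (≡.sym eq))))

∸-coprime : ∀ {a b} → b ℕ.≤ a → Coprime a b → Coprime (a ℕ.∸ b) b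
∸-coprime b≤a a⊥b (i∣a∸b , i∣b) = a⊥b (subst (_ ∣_) (ℕₚ.m∸n+n≡m b≤a) (∣m∣n⇒∣m+n i∣a∸b i∣b) , i∣b)

slope : ℕ → ℕ → Bool → Set
slope a b true  = a ℕ.≤ 2 ℕ.* b
slope a b false = 2 ℕ.* b ℕ.≤ a

stepPair-cfVal : ∀ a b → b ℕ.< a → Coprime a b → ∀ cf → IsCFOf cf (cfTarget a b) →
  ∀ t → slope a b t → stepPair t (cfVal cf) ≡ (a , b)
stepPair-cfVal a b b<a a⊥b cf@(s ∷ xs) isCF t sl with a ℕ.<ᵇ 2 ℕ.* b in e₁ | 2 ℕ.* b ℕ.<ᵇ a in e₂
stepPair-cfVal a b b<a a⊥b cf@(s ∷ xs) isCF true sl | true | _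
  rewrite coprime-fraction-unique (cfVal-coprime s xs) (coprime-sym (∸-coprime (ℕₚ.<⇒≤ b<a) a⊥b)) isCF =
  cong (_, b) (ℕₚ.m∸n+n≡m (ℕₚ.<⇒≤ b<a))
stepPair-cfVal a b b<a a⊥b cf@(s ∷ xs) isCF false sl | true | _ =
  contradiction (ℕₚ.<ᵇ⇒< a (2 ℕ.* b) (subst Bool.T (≡.sym e₁) _)) (ℕₚ.≤⇒≯ sl)
stepPair-cfVal a b b<a a⊥b cf@(s ∷ xs) isCF true sl | false | true =
  contradiction (ℕₚ.<ᵇ⇒< (2 ℕ.* b) a (subst Bool.T (≡.sym e₂) _)) (ℕₚ.≤⇒≯ sl)
stepPair-cfVal a b b<a a⊥b cf@(s ∷ xs) isCF false sl | false | true
  rewrite coprime-fraction-unique (cfVal-coprime s xs) (∸-coprime (ℕₚ.<⇒≤ b<a) a⊥b) isCF =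
  cong (_, b) (ℕₚ.m∸n+n≡m (ℕₚ.<⇒≤ b<a))
-- Here a = 2b, so coprimality leaves only (2,1), which both moves reach from (1,1).
stepPair-cfVal a b b<a a⊥b cf@(s ∷ xs) isCF t sl | false | false
  rewrite coprime-fraction-unique (cfVal-coprime s xs) (1-coprimeTo 1) isCF = lemma t
  where
  a≡2b : a ≡ 2 ℕ.* b
  a≡2b = ℕₚ.≤-antisym (ℕₚ.≮⇒≥ λ lt → subst Bool.T e₂ (ℕₚ.<⇒<ᵇ lt)) (ℕₚ.≮⇒≥ λ lt → subst Bool.T e₁ (ℕₚ.<⇒<ᵇ lt))
  b≡1 : b ≡ 1
  b≡1 = a⊥b (subst (b ∣_) (≡.sym a≡2b) (n∣m*n 2) , ∣-refl)
  a≡2 : a ≡ 2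
  a≡2 = ≡.trans a≡2b (cong (2 ℕ.*_) b≡1)
  lemma : ∀ t → stepPair t (1 , 1) ≡ (a , b)
  lemma true  = ≡.sym (cong₂ _,_ a≡2 b≡1)
  lemma false = ≡.sym (cong₂ _,_ a≡2 b≡1)

-- q-series over a commutative ring with integral powers of q

-- `E i` plays the role of q^i. The two laws make every `E i` invertible, so negative exponents are
-- harmless.
record Exponential {ℓ₁ ℓ₂ : Level} (R : CommutativeRing ℓ₁ ℓ₂) : Set (ℓ₁ ⊔ ℓ₂) where
  open CommutativeRing R hiding (zero; ring; _-_)
  field
    E   : ℤ → Carrier
    E-0 : E (+ 0) ≈ 1#
    E-+ : ∀ i j → E (i ℤ.+ j) ≈ E i * E j

module QSeries {ℓ₁ ℓ₂ : Level} (R : CommutativeRing ℓ₁ ℓ₂) (exponential : Exponential R) where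

  open Exponential exponential

  open CommutativeRing R hiding (zero; ring; _-_)
  open Algebra.Properties.Ring (CommutativeRing.ring R) using (-‿involutive; -0#≈0#; -‿distribˡ-*)
  open Algebra.Solver.Ring.NaturalCoefficients.Default commutativeSemiring using (solve; _:+_; _:*_; _:=_)
  open Relation.Binary.Reasoning.Setoid setoid
  module Sum = Algebra.Properties.Semiring.Sum semiring

  0*y≈0 : ∀ {x} y → x ≈ 0# → x * y ≈ 0#
  0*y≈0 y x≈0 = trans (*-congʳ x≈0) (zeroˡ y)

  x*0≈0 : ∀ x {y} → y ≈ 0# → x * y ≈ 0#
  x*0≈0 x y≈0 = trans (*-congˡ y≈0) (zeroʳ x)

  E-≡ : ∀ {i j} → i ≡ j → E i ≈ E j
  E-≡ p = reflexive (cong E p)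

  E-* : ∀ {i j k} → k ≡ i ℤ.+ j → E k ≈ E i * E j
  E-* {i} {j} p = trans (E-≡ p) (E-+ i j)

  -- Finite sums

  opaque
    sumTo : ℕ → (ℕ → Carrier) → Carrier
    sumTo n f = Sum.sum {n} (λ i → f (toℕ i))

    sumTo-cong : ∀ n {f g} → (∀ i → i ℕ.< n → f i ≈ g i) → sumTo n f ≈ sumTo n g
    sumTo-cong n h = Sum.sum-cong-≋ (λ i → h (toℕ i) (Finₚ.toℕ<n i))

    sumTo-0 : ∀ n {f} → (∀ i → i ℕ.< n → f i ≈ 0#) → sumTo n f ≈ 0#
    sumTo-0 n h = trans (sumTo-cong n h) (Sum.sum-replicate-zero n)

    sumTo-*ˡ : ∀ n x f → x * sumTo n f ≈ sumTo n (λ i → x * f i)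
    sumTo-*ˡ n x f = Sum.*-distribˡ-sum {n} x _

    sumTo-*ʳ : ∀ n x f → sumTo n f * x ≈ sumTo n (λ i → f i * x)
    sumTo-*ʳ n x f = Sum.*-distribʳ-sum {n} x _

    sumTo-+ : ∀ n f g → sumTo n (λ i → f i + g i) ≈ sumTo n f + sumTo n g
    sumTo-+ n f g = Sum.∑-distrib-+ {n} _ _

    sumTo-swap : ∀ m n (f : ℕ → ℕ → Carrier) →
      sumTo m (λ i → sumTo n (f i)) ≈ sumTo n (λ j → sumTo m (λ i → f i j))
    sumTo-swap m n f = Sum.∑-comm {m} {n} _

    sumTo-++ : ∀ m n f → sumTo (m ℕ.+ n) f ≈ sumTo m f + sumTo n (f ∘ (m ℕ.+_))
    sumTo-++ zero    n f = sym (+-identityˡ _)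
    sumTo-++ (suc m) n f = trans (+-congˡ (sumTo-++ m n (f ∘ suc))) (sym (+-assoc _ _ _))

    sumTo-last : ∀ n f → sumTo (suc n) f ≈ sumTo n f + f n
    sumTo-last zero    f = trans (+-identityʳ _) (sym (+-identityˡ _))
    sumTo-last (suc n) f = trans (+-congˡ (sumTo-last n (f ∘ suc))) (sym (+-assoc _ _ _))

    sumTo-suc : ∀ n f → sumTo (suc n) f ≈ f 0 + sumTo n (f ∘ suc)
    sumTo-suc n f = refl

    sumTo-zero : ∀ f → sumTo zero f ≈ 0#
    sumTo-zero f = refl

  sumTo-drop : ∀ m n {f} → (∀ i → i ℕ.< m → f i ≈ 0#) → sumTo (m ℕ.+ n) f ≈ sumTo n (f ∘ (m ℕ.+_))
  sumTo-drop m n {f} h = trans (sumTo-++ m n f) (trans (+-congʳ (sumTo-0 m h)) (+-identityˡ _))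

  sumTo-trunc : ∀ {m n} {f} → m ℕ.≤ n → (∀ i → m ℕ.≤ i → f i ≈ 0#) → sumTo n f ≈ sumTo m f
  sumTo-trunc {m} {n} {f} m≤n h with k , ≡.refl ← ℕₚ.m≤n⇒∃[o]m+o≡n m≤n =
    trans (sumTo-++ m k f) (trans (+-congˡ (sumTo-0 k (λ i _ → h (m ℕ.+ i) (ℕₚ.m≤m+n m i)))) (+-identityʳ _))

  sumTo-reverse : ∀ n f → sumTo (suc n) f ≈ sumTo (suc n) (λ i → f (n ℕ.∸ i))
  sumTo-reverse zero    f = sumTo-cong 1 λ { zero _ → refl ; (suc _) (s≤s ()) }
  sumTo-reverse (suc n) f = begin
    sumTo (suc (suc n)) f                                ≈⟨ sumTo-suc (suc n) f ⟩
    f 0 + sumTo (suc n) (f ∘ suc)                        ≈⟨ +-comm _ _ ⟩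
    sumTo (suc n) (f ∘ suc) + f 0                        ≈⟨ +-congʳ (sumTo-reverse n (f ∘ suc)) ⟩
    sumTo (suc n) (λ i → f (suc (n ℕ.∸ i))) + f 0        ≈⟨ +-cong (sumTo-cong (suc n) λ i i<sn →
                                                              reflexive (cong f (≡.sym (ℕₚ.+-∸-assoc 1 (ℕₚ.≤-pred i<sn)))))
                                                              (reflexive (cong f (≡.sym (ℕₚ.n∸n≡0 n)))) ⟩
    sumTo (suc n) (λ i → f (suc n ℕ.∸ i)) + f (n ℕ.∸ n)  ≈⟨ sumTo-last (suc n) (λ i → f (suc n ℕ.∸ i)) ⟨
    sumTo (suc (suc n)) (λ i → f (suc n ℕ.∸ i))          ∎

  opaque
    -- The range is -K ≤ j ≤ K, since `-[1+ i ]` is -1-i; raising K by one adds one term at each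
    -- end.
    sumℤ± : ℕ → (ℤ → Carrier) → Carrier
    sumℤ± K f = sumTo (suc K) (f ∘ +_) + sumTo K (f ∘ -[1+_])

    sumℤ±-split : ∀ K f → sumℤ± K f ≈ sumTo (suc K) (f ∘ +_) + sumTo K (f ∘ -[1+_])
    sumℤ±-split K f = refl

    sumℤ±-cong : ∀ K {f g} → (∀ j → f j ≈ g j) → sumℤ± K f ≈ sumℤ± K g
    sumℤ±-cong K h = +-cong (sumTo-cong (suc K) (λ i _ → h (+ i))) (sumTo-cong K (λ i _ → h -[1+ i ]))

    sumℤ±-*ˡ : ∀ K x f → x * sumℤ± K f ≈ sumℤ± K (λ j → x * f j)
    sumℤ±-*ˡ K x f = trans (distribˡ _ _ _) (+-cong (sumTo-*ˡ (suc K) x _) (sumTo-*ˡ K x _))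

    sumℤ±-+ : ∀ K f g → sumℤ± K (λ j → f j + g j) ≈ sumℤ± K f + sumℤ± K g
    sumℤ±-+ K f g = trans (+-cong (sumTo-+ (suc K) _ _) (sumTo-+ K _ _)) (interchange _ _ _ _)
      where
      interchange : ∀ w x y z → (w + x) + (y + z) ≈ (w + y) + (x + z)
      interchange = solve 4 (λ w x y z → (w :+ x) :+ (y :+ z) := (w :+ y) :+ (x :+ z)) refl

    sumℤ±-swap : ∀ K n (f : ℤ → ℕ → Carrier) →
      sumℤ± K (λ j → sumTo n (f j)) ≈ sumTo n (λ r → sumℤ± K (λ j → f j r))
    sumℤ±-swap K n f = trans (+-cong (sumTo-swap (suc K) n _) (sumTo-swap K n _)) (sym (sumTo-+ n _ _))

    sumℤ±-suc : ∀ K f → sumℤ± (suc K) f ≈ sumℤ± K f + (f (+ suc K) + f -[1+ K ])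
    sumℤ±-suc K f = trans (+-cong (sumTo-last (suc K) (f ∘ +_)) (sumTo-last K (f ∘ -[1+_]))) (interchange _ _ _ _)
      where
      interchange : ∀ w x y z → (w + x) + (y + z) ≈ (w + y) + (x + z)
      interchange = solve 4 (λ w x y z → (w :+ x) :+ (y :+ z) := (w :+ y) :+ (x :+ z)) refl

    sumℤ±-zero : ∀ f → sumℤ± 0 f ≈ f (+ 0)
    sumℤ±-zero f = trans (+-cong (trans (sumTo-suc 0 _) (+-congˡ (sumTo-zero _))) (sumTo-zero _)) (trans (+-identityʳ _) (+-identityʳ _))

  cancel-last : ∀ x y → x + (y + - x) ≈ y
  cancel-last x y = begin
    x + (y + - x)  ≈⟨ +-congˡ (+-comm _ _) ⟩
    x + (- x + y)  ≈⟨ +-assoc _ _ _ ⟨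
    x + - x + y    ≈⟨ +-congʳ (-‿inverseʳ x) ⟩
    0# + y         ≈⟨ +-identityˡ y ⟩
    y              ∎

  -- The reflection j ↔ -1-j pairs off everything except j = K, whose partner lies outside the
  -- range.
  sumℤ±-antisym₋₁ : ∀ K f → (∀ j → f -[1+ j ] ≈ - f (+ j)) → sumℤ± K f ≈ f (+ K)
  sumℤ±-antisym₋₁ zero    f h = sumℤ±-zero f
  sumℤ±-antisym₋₁ (suc K) f h = begin
    sumℤ± (suc K) f                       ≈⟨ sumℤ±-suc K f ⟩
    sumℤ± K f + (f (+ suc K) + f -[1+ K ]) ≈⟨ +-cong (sumℤ±-antisym₋₁ K f h) (+-congˡ (h K)) ⟩
    f (+ K) + (f (+ suc K) + - f (+ K))    ≈⟨ cancel-last _ _ ⟩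
    f (+ suc K)                            ∎

  -- The reflection j ↔ 1-j leaves only j = -K unpaired, and its value is expressed through the
  -- partner K+1. The pair 0 ↔ 1 needs its own hypothesis because `-[1+ j ]` does not reach 0.
  sumℤ±-antisym₁ : ∀ K f → f (+ 0) ≈ - f (+ 1) → (∀ j → f -[1+ j ] ≈ - f (+ suc (suc j))) →
    sumℤ± K f ≈ - f (+ suc K)
  sumℤ±-antisym₁ zero    f h₀ h = trans (sumℤ±-zero f) h₀
  sumℤ±-antisym₁ (suc K) f h₀ h = begin
    sumℤ± (suc K) f                                          ≈⟨ sumℤ±-suc K f ⟩
    sumℤ± K f + (f (+ suc K) + f -[1+ K ])                   ≈⟨ +-cong (sumℤ±-antisym₁ K f h₀ h) (+-congˡ (h K)) ⟩
    - f (+ suc K) + (f (+ suc K) + - f (+ suc (suc K)))      ≈⟨ +-assoc _ _ _ ⟨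
    - f (+ suc K) + f (+ suc K) + - f (+ suc (suc K))        ≈⟨ +-congʳ (-‿inverseˡ _) ⟩
    0# + - f (+ suc (suc K))                                 ≈⟨ +-identityˡ _ ⟩
    - f (+ suc (suc K))                                      ∎

  sumTo-negatives : ∀ K f → sumTo K (λ i → f (+ i ℤ.- + K)) ≈ sumTo K (f ∘ -[1+_])
  sumTo-negatives zero    f = trans (sumTo-zero _) (sym (sumTo-zero _))
  sumTo-negatives (suc K) f = begin
    sumTo (suc K) (λ i → f (+ i ℤ.- + suc K))              ≈⟨ sumTo-suc K _ ⟩
    f -[1+ K ] + sumTo K (λ i → f (+ suc i ℤ.- + suc K))   ≈⟨ +-congˡ (sumTo-cong K λ i _ → reflexive (cong f (shift (+ i) (+ K)))) ⟩
    f -[1+ K ] + sumTo K (λ i → f (+ i ℤ.- + K))           ≈⟨ +-congˡ (sumTo-negatives K f) ⟩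
    f -[1+ K ] + sumTo K (f ∘ -[1+_])                      ≈⟨ +-comm _ _ ⟩
    sumTo K (f ∘ -[1+_]) + f -[1+ K ]                      ≈⟨ sumTo-last K _ ⟨
    sumTo (suc K) (f ∘ -[1+_])                             ∎
    where
    shift : ∀ i j → (+ 1 ℤ.+ i) ℤ.- (+ 1 ℤ.+ j) ≡ i ℤ.- j
    shift = ℤS.solve-∀

  sumTo-symmetric-range : ∀ K f → sumTo (suc (2 ℕ.* K)) (λ i → f (+ i ℤ.- + K)) ≈ sumℤ± K f
  sumTo-symmetric-range K f = begin
    sumTo (suc (2 ℕ.* K)) g                      ≈⟨ reflexive (cong (λ n → sumTo n g) (≡.trans (cong (λ x → suc (K ℕ.+ x)) (ℕₚ.+-identityʳ K)) (≡.sym (ℕₚ.+-suc K K)))) ⟩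
    sumTo (K ℕ.+ suc K) g                        ≈⟨ sumTo-++ K (suc K) g ⟩
    sumTo K g + sumTo (suc K) (g ∘ (K ℕ.+_))     ≈⟨ +-cong (sumTo-negatives K f) (sumTo-cong (suc K) λ i _ → reflexive (cong f (cancel (+ K) (+ i)))) ⟩
    sumTo K (f ∘ -[1+_]) + sumTo (suc K) (f ∘ +_) ≈⟨ +-comm _ _ ⟩
    sumTo (suc K) (f ∘ +_) + sumTo K (f ∘ -[1+_]) ≈⟨ sumℤ±-split K f ⟨
    sumℤ± K f                                    ∎
    where
    g : ℕ → Carrier
    g i = f (+ i ℤ.- + K)
    cancel : ∀ x y → x ℤ.+ y ℤ.- x ≡ y
    cancel = ℤS.solve-∀

  -- Gaussian binomial coefficients

  -- Pascal's rule replaces the quotient of q-factorials, as the ring need not allow division; it is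
  -- the recursion of `qbinℕ`.
  G : ℕ → ℕ → Carrier
  G n       zero    = 1#
  G zero    (suc m) = 0#
  G (suc n) (suc m) = G n m + E (+ suc m) * G n (suc m)

  Gℤ : ℕ → ℤ → Carrier
  Gℤ n (+ m)    = G n m
  Gℤ n -[1+ m ] = 0#

  G-above : ∀ {n m} → n ℕ.< m → G n m ≈ 0#
  G-above {zero}  {suc m} _       = refl
  G-above {suc n} {suc m} (s≤s p) =
    trans (+-cong (G-above p) (x*0≈0 _ (G-above (ℕₚ.m≤n⇒m≤1+n p)))) (+-identityˡ _)

  G-diagonal : ∀ n → G n n ≈ 1#
  G-diagonal zero    = refl
  G-diagonal (suc n) = trans (+-cong (G-diagonal n) (x*0≈0 _ (G-above (ℕₚ.n<1+n n)))) (+-identityʳ _)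

  -- The mirror of the defining rule, with the power of q on the other term. For m > n the exponent
  -- is negative, but there it multiplies 0.
  G-pascalʳ : ∀ n m → G (suc n) (suc m) ≈ G n (suc m) + E (+ n ℤ.- + m) * G n m
  G-pascalʳ zero zero = begin
    1# + E (+ 1) * 0#   ≈⟨ +-congˡ (zeroʳ _) ⟩
    1# + 0#             ≈⟨ +-comm _ _ ⟩
    0# + 1#             ≈⟨ +-congˡ E-0 ⟨
    0# + E (+ 0)        ≈⟨ +-congˡ (*-identityʳ _) ⟨
    0# + E (+ 0) * 1#   ∎
  G-pascalʳ zero (suc m) = +-congˡ (trans (zeroʳ _) (sym (zeroʳ _)))
  G-pascalʳ (suc n) zero = begin
    1# + E (+ 1) * G (suc n) 1                                ≈⟨ +-congˡ (*-congˡ (G-pascalʳ n 0)) ⟩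
    1# + E (+ 1) * (G n 1 + E (+ n ℤ.- + 0) * 1#)             ≈⟨ expand _ _ _ _ _ ⟩
    1# + E (+ 1) * G n 1 + E (+ 1) * E (+ n ℤ.- + 0) * 1#     ≈⟨ +-congˡ (*-congʳ (sym (E-* (shift (+ n))))) ⟩
    1# + E (+ 1) * G n 1 + E (+ suc n ℤ.- + 0) * 1#           ∎
    where
    expand : ∀ o x y z w → o + x * (y + z * w) ≈ o + x * y + x * z * w
    expand = solve 5 (λ o x y z w → o :+ x :* (y :+ z :* w) := o :+ x :* y :+ x :* z :* w) refl
    shift : ∀ i → (+ 1 ℤ.+ i) ℤ.- + 0 ≡ + 1 ℤ.+ (i ℤ.- + 0)
    shift = ℤS.solve-∀
  G-pascalʳ (suc n) (suc m) = begin
    G (suc n) (suc m) + E (+ suc (suc m)) * G (suc n) (suc (suc m))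
      ≈⟨ +-cong (G-pascalʳ n m) (*-congˡ (G-pascalʳ n (suc m))) ⟩
    (G n (suc m) + E (+ n ℤ.- + m) * G n m) + E (+ suc (suc m)) * (G n (suc (suc m)) + E (+ n ℤ.- + suc m) * G n (suc m))
      ≈⟨ expandˡ _ _ _ _ _ _ ⟩
    (G n (suc m) + E (+ suc (suc m)) * G n (suc (suc m))) + (E (+ n ℤ.- + m) * G n m + E (+ suc (suc m)) * E (+ n ℤ.- + suc m) * G n (suc m))
      ≈⟨ +-congˡ (+-congˡ (*-congʳ (trans (sym (E-+ _ _)) (E-* (exponents (+ n) (+ m)))))) ⟩
    (G n (suc m) + E (+ suc (suc m)) * G n (suc (suc m))) + (E (+ n ℤ.- + m) * G n m + E (+ n ℤ.- + m) * E (+ suc m) * G n (suc m))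
      ≈⟨ +-congˡ (collect _ _ _ _) ⟩
    (G n (suc m) + E (+ suc (suc m)) * G n (suc (suc m))) + E (+ n ℤ.- + m) * (G n m + E (+ suc m) * G n (suc m))
      ≈⟨ +-congˡ (*-congʳ (E-≡ (shift (+ n) (+ m)))) ⟩
    (G n (suc m) + E (+ suc (suc m)) * G n (suc (suc m))) + E (+ suc n ℤ.- + suc m) * (G n m + E (+ suc m) * G n (suc m)) ∎
    where
    expandˡ : ∀ a b c d e f → (a + b) + c * (d + e * f) ≈ (a + c * d) + (b + c * e * f)
    expandˡ = solve 6 (λ a b c d e f → (a :+ b) :+ c :* (d :+ e :* f) := (a :+ c :* d) :+ (b :+ c :* e :* f)) refl
    collect : ∀ a b c d → a * b + a * c * d ≈ a * (b + c * d)
    collect = solve 4 (λ a b c d → a :* b :+ a :* c :* d := a :* (b :+ c :* d)) refl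
    exponents : ∀ i j → (+ 2 ℤ.+ j) ℤ.+ (i ℤ.- (+ 1 ℤ.+ j)) ≡ (i ℤ.- j) ℤ.+ (+ 1 ℤ.+ j)
    exponents = ℤS.solve-∀
    shift : ∀ i j → i ℤ.- j ≡ (+ 1 ℤ.+ i) ℤ.- (+ 1 ℤ.+ j)
    shift = ℤS.solve-∀

  Gℤ-pascalʳ : ∀ n k → Gℤ (suc n) k ≈ Gℤ n k + E (+ suc n ℤ.- k) * Gℤ n (k ℤ.- + 1)
  Gℤ-pascalʳ n (+ zero)  = sym (trans (+-congˡ (zeroʳ _)) (+-identityʳ _))
  Gℤ-pascalʳ n (+ suc m) = trans (G-pascalʳ n m) (+-congˡ (*-congʳ (E-≡ (shift (+ n) (+ m)))))
    where
    shift : ∀ i j → i ℤ.- j ≡ (+ 1 ℤ.+ i) ℤ.- (+ 1 ℤ.+ j)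
    shift = ℤS.solve-∀
  Gℤ-pascalʳ n -[1+ m ]  = sym (trans (+-congˡ (zeroʳ _)) (+-identityʳ _))

  -- The defining rule on one side and its mirror on the other agree term by term.
  G-sym : ∀ i j → G (i ℕ.+ j) i ≈ G (i ℕ.+ j) j
  G-sym zero    j       = sym (G-diagonal j)
  G-sym (suc i) zero    rewrite ℕₚ.+-identityʳ i = G-diagonal (suc i)
  G-sym (suc i) (suc j) = begin
    G (i ℕ.+ suc j) i + E (+ suc i) * G (i ℕ.+ suc j) (suc i)
      ≈⟨ +-cong (G-sym i (suc j)) (*-cong (E-≡ (exponent (+ i) (+ j))) flipped) ⟩
    G (i ℕ.+ suc j) (suc j) + E (+ (i ℕ.+ suc j) ℤ.- + j) * G (i ℕ.+ suc j) j
      ≈⟨ G-pascalʳ (i ℕ.+ suc j) j ⟨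
    G (suc (i ℕ.+ suc j)) (suc j) ∎
    where
    flipped : G (i ℕ.+ suc j) (suc i) ≈ G (i ℕ.+ suc j) j
    flipped rewrite ℕₚ.+-suc i j = G-sym (suc i) j
    exponent : ∀ x y → + 1 ℤ.+ x ≡ (x ℤ.+ (+ 1 ℤ.+ y)) ℤ.- y
    exponent = ℤS.solve-∀

  -- The gap d turns the inequality into an equation between integers, so that index conditions
  -- become ring identities.
  Gℤ-neg : ∀ n {k} d → k ≡ ℤ.- + suc d → Gℤ n k ≈ 0#
  Gℤ-neg n d ≡.refl = refl

  Gℤ-above : ∀ n {k} d → k ≡ + n ℤ.+ + suc d → Gℤ n k ≈ 0#
  Gℤ-above n d ≡.refl = G-above (ℕₚ.m<m+n n (s≤s z≤n))

  Gℤ-sym : ∀ n {k l} → k ℤ.+ l ≡ + n → Gℤ n k ≈ Gℤ n l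
  Gℤ-sym n {+ i}      {+ j}      ≡.refl = G-sym i j
  Gℤ-sym n {+ i}      { -[1+ j ]} eq    = Gℤ-above n {+ i} j (≡.trans (≡.sym (cancel (+ i) -[1+ j ])) (cong (ℤ._- -[1+ j ]) eq))
    where
    cancel : ∀ x y → x ℤ.+ y ℤ.- y ≡ x
    cancel = ℤS.solve-∀
  Gℤ-sym n { -[1+ i ]} {+ j}      eq    = sym (Gℤ-above n {+ j} i (≡.trans (≡.sym (cancel -[1+ i ] (+ j))) (cong (ℤ._- -[1+ i ]) eq)))
    where
    cancel : ∀ x y → x ℤ.+ y ℤ.- x ≡ y
    cancel = ℤS.solve-∀
  Gℤ-sym n { -[1+ i ]} { -[1+ j ]} eq   = refl

  opaque
    -- Integer arguments avoid truncated subtraction; a negative top gives 0, in agreement with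
    -- `qbin`.
    Q : ℤ → ℤ → Carrier
    Q (+ n)    m = Gℤ n m
    Q -[1+ n ] m = 0#

    Q-neg : ∀ {n k} d → k ≡ ℤ.- + suc d → Q n k ≈ 0#
    Q-neg {+ n}      d eq = Gℤ-neg n d eq
    Q-neg { -[1+ n ]} d eq = refl

    Q-above : ∀ {n k} d → k ≡ n ℤ.+ + suc d → Q n k ≈ 0#
    Q-above {+ n}      d eq = Gℤ-above n d eq
    Q-above { -[1+ n ]} d eq = refl

    Q≡Gℤ : ∀ n k → Q (+ n) k ≡ Gℤ n k
    Q≡Gℤ n k = ≡.refl

    Q-negative-top : ∀ n k → Q -[1+ n ] k ≡ 0#
    Q-negative-top n k = ≡.refl

    Q-sym : ∀ {n m k l} → n ≡ m → k ℤ.+ l ≡ n → Q n k ≈ Q m l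
    Q-sym {+ n}      {k = k} {l} ≡.refl eq = Gℤ-sym n {k} {l} eq
    Q-sym { -[1+ n ]}             ≡.refl eq = refl

    Q-at : ∀ {n k} m l → n ≡ + m → k ≡ l → Q n k ≈ Gℤ m l
    Q-at m l ≡.refl ≡.refl = refl

    Q≈Gℤ : ∀ {n k} m l → n ≡ + m → k ℤ.+ l ≡ + m → Q n k ≈ Gℤ m l
    Q≈Gℤ {k = k} m l ≡.refl eq = Gℤ-sym m {k} {l} eq

  -- Both sides are the q-multinomial coefficient of i + j + k with parts i, j, k. Without division,
  -- this is proved through the recurrence that removes one from each part in turn.
  G-trinomial : ∀ i j k {n m p} → n ≡ i ℕ.+ m → m ≡ j ℕ.+ k → p ≡ i ℕ.+ j →
    G n i * G m j ≈ G n p * G p i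
  G-trinomial zero j k ≡.refl ≡.refl ≡.refl = *-comm _ _
  G-trinomial (suc i) zero k ≡.refl ≡.refl ≡.refl rewrite ℕₚ.+-identityʳ i = *-congˡ (sym (G-diagonal (suc i)))
  G-trinomial (suc i) (suc j) zero ≡.refl ≡.refl ≡.refl rewrite ℕₚ.+-identityʳ j =
    trans (trans (*-congˡ (G-diagonal (suc j))) (*-comm _ _)) (*-congʳ (sym (G-diagonal (suc i ℕ.+ suc j))))
  G-trinomial (suc i) (suc j) (suc k) ≡.refl ≡.refl ≡.refl = begin
    (G n i + E (+ suc i) * G n (suc i)) * G m (suc j)
      ≈⟨ expandˡ _ _ _ _ ⟩
    G n i * G m (suc j) + E (+ suc i) * (G n (suc i) * (G m′ j + E (+ suc j) * G m′ (suc j)))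
      ≈⟨ expandʳ _ _ _ _ _ _ ⟩
    G n i * G m (suc j) + E (+ suc i) * (G n (suc i) * G m′ j) + E (+ suc i) * E (+ suc j) * (G n (suc i) * G m′ (suc j))
      -- The three induction hypotheses lower the first, the second and the third part.
      ≈⟨ +-cong (+-cong (G-trinomial i (suc j) (suc k) ≡.refl ≡.refl ≡.refl)
                        (*-congˡ (G-trinomial (suc i) j (suc k) (ℕₚ.+-suc i m′) ≡.refl (ℕₚ.+-suc i j))))
                (*-cong (sym (E-+ _ _)) (G-trinomial (suc i) (suc j) k (ℕₚ.+-suc i m′) (ℕₚ.+-suc j k) ≡.refl)) ⟩
    G n p * G p i + E (+ suc i) * (G n p * G p (suc i)) + E (+ suc p) * (G n (suc p) * G (suc p) (suc i))
      ≈⟨ collect _ _ _ _ _ _ ⟩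
    (G n p + E (+ suc p) * G n (suc p)) * (G p i + E (+ suc i) * G p (suc i)) ∎
    where
    m′ = j ℕ.+ suc k
    m = suc m′
    n = i ℕ.+ m
    p = i ℕ.+ suc j
    expandˡ : ∀ a b c d → (a + b * c) * d ≈ a * d + b * (c * d)
    expandˡ = solve 4 (λ a b c d → (a :+ b :* c) :* d := a :* d :+ b :* (c :* d)) refl
    expandʳ : ∀ a b c d e f → a + b * (c * (d + e * f)) ≈ a + b * (c * d) + b * e * (c * f)
    expandʳ = solve 6 (λ a b c d e f → a :+ b :* (c :* (d :+ e :* f)) := a :+ b :* (c :* d) :+ b :* e :* (c :* f)) refl
    collect : ∀ a b c d e f → a * b + c * (a * d) + e * (f * (b + c * d)) ≈ (a + e * f) * (b + c * d)
    collect = solve 6 (λ a b c d e f → a :* b :+ c :* (a :* d) :+ e :* (f :* (b :+ c :* d)) := (a :+ e :* f) :* (b :+ c :* d)) refl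

  -- The q-Vandermonde and q-Saalschütz sums

  -- Induction on m by the mirror Pascal rule for [m+1; u]: one half is the sum for (m, r); the
  -- other, after shifting u, is q^(m+1+n-r) times the sum for (m, r-1). The shift shortens the
  -- range, so the bound K is left free.
  q-Vandermonde : ∀ m n r {K} → m ℕ.< K →
    sumTo K (λ u → E (+ u ℤ.* (+ n ℤ.- r ℤ.+ + u)) * (G m u * Gℤ n (r ℤ.- + u))) ≈ Gℤ (m ℕ.+ n) r
  q-Vandermonde zero n r {suc K} _ = begin
    sumTo (suc K) f      ≈⟨ sumTo-suc K f ⟩
    f 0 + sumTo K (f ∘ suc)  ≈⟨ +-cong head (sumTo-0 K λ i _ → x*0≈0 _ (zeroˡ _)) ⟩
    Gℤ n r + 0#          ≈⟨ +-identityʳ _ ⟩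
    Gℤ n r               ∎
    where
    f = λ u → E (+ u ℤ.* (+ n ℤ.- r ℤ.+ + u)) * (G 0 u * Gℤ n (r ℤ.- + u))
    head : f 0 ≈ Gℤ n r
    head = trans (*-cong (trans (E-≡ (ℤₚ.*-zeroˡ (+ n ℤ.- r ℤ.+ + 0))) E-0) (trans (*-identityˡ _) (reflexive (cong (Gℤ n) (ℤₚ.+-identityʳ r)))))
                 (*-identityˡ _)
  q-Vandermonde (suc m) n r {suc K} (s≤s m<K) = begin
    sumTo (suc K) (λ u → x u * (G (suc m) u * y u))
      ≈⟨ sumTo-cong (suc K) (λ u _ → trans (*-congˡ (*-congʳ (Gℤ-pascalʳ m (+ u)))) (expand _ _ _ _ _)) ⟩
    sumTo (suc K) (λ u → x u * (G m u * y u) + g u)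
      ≈⟨ sumTo-+ (suc K) _ _ ⟩
    sumTo (suc K) (λ u → x u * (G m u * y u)) + sumTo (suc K) g
      ≈⟨ +-cong (q-Vandermonde m n r (ℕₚ.m≤n⇒m≤1+n m<K)) second ⟩
    Gℤ (m ℕ.+ n) r + E (+ suc (m ℕ.+ n) ℤ.- r) * Gℤ (m ℕ.+ n) (r ℤ.- + 1)
      ≈⟨ Gℤ-pascalʳ (m ℕ.+ n) r ⟨
    Gℤ (suc m ℕ.+ n) r ∎
    where
    x y g h : ℕ → Carrier
    x u = E (+ u ℤ.* (+ n ℤ.- r ℤ.+ + u))
    y u = Gℤ n (r ℤ.- + u)
    g u = (x u * E (+ suc m ℤ.- + u)) * (Gℤ m (+ u ℤ.- + 1) * y u)
    h u = E (+ u ℤ.* (+ n ℤ.- (r ℤ.- + 1) ℤ.+ + u)) * (G m u * Gℤ n (r ℤ.- + 1 ℤ.- + u))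
    expand : ∀ a b c d e → a * ((b + c * d) * e) ≈ a * (b * e) + a * c * (d * e)
    expand = solve 5 (λ a b c d e → a :* ((b :+ c :* d) :* e) := a :* (b :* e) :+ a :* c :* (d :* e)) refl
    exponents : ∀ u m n r →
      (+ 1 ℤ.+ u) ℤ.* (n ℤ.- r ℤ.+ (+ 1 ℤ.+ u)) ℤ.+ ((+ 1 ℤ.+ m) ℤ.- (+ 1 ℤ.+ u)) ≡
      (+ 1 ℤ.+ (m ℤ.+ n) ℤ.- r) ℤ.+ u ℤ.* (n ℤ.- (r ℤ.- + 1) ℤ.+ u)
    exponents = ℤS.solve-∀
    indices : ∀ r u → r ℤ.- (+ 1 ℤ.+ u) ≡ r ℤ.- + 1 ℤ.- u
    indices = ℤS.solve-∀
    g-suc : ∀ u → g (suc u) ≈ E (+ suc (m ℕ.+ n) ℤ.- r) * h u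
    g-suc u = trans
      (*-cong (trans (sym (E-+ _ _)) (E-* (exponents (+ u) (+ m) (+ n) r)))
              (*-congˡ (reflexive (cong (Gℤ n) (indices r (+ u))))))
      (*-assoc _ _ _)
    second : sumTo (suc K) g ≈ E (+ suc (m ℕ.+ n) ℤ.- r) * Gℤ (m ℕ.+ n) (r ℤ.- + 1)
    second = begin
      sumTo (suc K) g                                 ≈⟨ sumTo-suc K g ⟩
      g 0 + sumTo K (g ∘ suc)                         ≈⟨ +-cong (x*0≈0 _ (zeroˡ _)) (sumTo-cong K λ u _ → g-suc u) ⟩
      0# + sumTo K (λ u → E (+ suc (m ℕ.+ n) ℤ.- r) * h u) ≈⟨ +-identityˡ _ ⟩
      sumTo K (λ u → E (+ suc (m ℕ.+ n) ℤ.- r) * h u) ≈⟨ sumTo-*ˡ K _ h ⟨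
      E (+ suc (m ℕ.+ n) ℤ.- r) * sumTo K h           ≈⟨ *-congˡ (q-Vandermonde m n (r ℤ.- + 1) m<K) ⟩
      E (+ suc (m ℕ.+ n) ℤ.- r) * Gℤ (m ℕ.+ n) (r ℤ.- + 1) ∎

  G-revision : ∀ {A k s} → k ℕ.≤ A → s ℕ.≤ A → G A k * Gℤ (A ℕ.∸ k) (+ s ℤ.- + k) ≈ G A s * G s k
  G-revision {A} {k} {s} k≤A s≤A with k ℕ.≤? s
  ... | yes k≤s with j , ≡.refl ← ℕₚ.m≤n⇒∃[o]m+o≡n k≤s with i , ≡.refl ← ℕₚ.m≤n⇒∃[o]m+o≡n s≤A =
    trans (*-congˡ (reflexive (cong (Gℤ _) (cancel (+ k) (+ j)))))
          (G-trinomial k j i (≡.sym (ℕₚ.m+[n∸m]≡n k≤A))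
            (≡.trans (cong (ℕ._∸ k) (ℕₚ.+-assoc k j i)) (ℕₚ.m+n∸m≡n k (j ℕ.+ i))) ≡.refl)
    where
    cancel : ∀ x y → x ℤ.+ y ℤ.- x ≡ y
    cancel = ℤS.solve-∀
  G-revision {A} {k} {s} k≤A s≤A | no k≰s with d , ≡.refl ← ℕₚ.m≤n⇒∃[o]m+o≡n (ℕₚ.≰⇒> k≰s) =
    trans (x*0≈0 _ (Gℤ-neg _ d (cancel (+ s) (+ d)))) (sym (x*0≈0 _ (G-above (s≤s (ℕₚ.m≤m+n s d)))))
    where
    cancel : ∀ x y → x ℤ.- (+ 1 ℤ.+ (x ℤ.+ y)) ≡ ℤ.- (+ 1 ℤ.+ y)
    cancel = ℤS.solve-∀

  -- Three Vandermonde sums: one splits the first binomial and introduces s, one evaluates the sum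
  -- over k, and one the remaining sum over s. Regrouping products of two binomials in between
  -- separates the variables.
  q-Saalschütz : ∀ A B N c →
    sumTo (suc A) (λ k → E (+ k ℤ.* (+ k ℤ.+ + c)) * (Gℤ (A ℕ.∸ k ℕ.+ (B ℕ.+ N)) (+ N ℤ.- + k) * (G A k * G B (k ℕ.+ c))))
      ≈ G (A ℕ.+ (N ℕ.+ c)) N * G (B ℕ.+ N) (N ℕ.+ c)
  q-Saalschütz A B N c = begin
    sumTo (suc A) (λ k → E (+ k ℤ.* (+ k ℤ.+ + c)) * (Gℤ (A ℕ.∸ k ℕ.+ (B ℕ.+ N)) (+ N ℤ.- + k) * (G A k * G B (k ℕ.+ c))))
      ≈⟨ sumTo-cong (suc A) (λ k k<sA → expand k (ℕₚ.≤-pred k<sA)) ⟩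
    sumTo (suc A) (λ k → sumTo (suc A) (λ s → outer s * inner s k))
      ≈⟨ sumTo-swap (suc A) (suc A) _ ⟩
    sumTo (suc A) (λ s → sumTo (suc A) (λ k → outer s * inner s k))
      ≈⟨ sumTo-cong (suc A) (λ s s<sA → trans (sym (sumTo-*ˡ (suc A) (outer s) (inner s)))
           (trans (*-congˡ (inner-sum s (ℕₚ.≤-pred s<sA))) (final s))) ⟩
    sumTo (suc A) (λ s → (E (+ s ℤ.* (+ (N ℕ.+ c) ℤ.- + N ℤ.+ + s)) * (G A s * Gℤ (N ℕ.+ c) (+ N ℤ.- + s))) * G (B ℕ.+ N) (N ℕ.+ c))
      ≈⟨ sumTo-*ʳ (suc A) _ _ ⟨
    sumTo (suc A) (λ s → E (+ s ℤ.* (+ (N ℕ.+ c) ℤ.- + N ℤ.+ + s)) * (G A s * Gℤ (N ℕ.+ c) (+ N ℤ.- + s))) * G (B ℕ.+ N) (N ℕ.+ c)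
      ≈⟨ *-congʳ (q-Vandermonde A (N ℕ.+ c) (+ N) ℕₚ.≤-refl) ⟩
    G (A ℕ.+ (N ℕ.+ c)) N * G (B ℕ.+ N) (N ℕ.+ c) ∎
    where
    outer : ℕ → Carrier
    outer s = E (+ s ℤ.* (+ s ℤ.+ + c)) * (G A s * Gℤ (B ℕ.+ N) (+ N ℤ.- + s))
    inner : ℕ → ℕ → Carrier
    inner s k = E ((+ s ℤ.- + k) ℤ.* (+ B ℤ.- + k ℤ.- + c)) * (G s k * G B (k ℕ.+ c))

    -- [A-k+B+N; N-k] is expanded by Vandermonde along A-k, with summation variable s-k.
    expand : ∀ k → k ℕ.≤ A →
      E (+ k ℤ.* (+ k ℤ.+ + c)) * (Gℤ (A ℕ.∸ k ℕ.+ (B ℕ.+ N)) (+ N ℤ.- + k) * (G A k * G B (k ℕ.+ c)))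
        ≈ sumTo (suc A) (λ s → outer s * inner s k)
    expand k k≤A = begin
      e * (Gℤ (A ℕ.∸ k ℕ.+ (B ℕ.+ N)) (+ N ℤ.- + k) * w)
        ≈⟨ *-congˡ (*-congʳ (sym (q-Vandermonde (A ℕ.∸ k) (B ℕ.+ N) (+ N ℤ.- + k) ℕₚ.≤-refl))) ⟩
      e * (sumTo (suc (A ℕ.∸ k)) f * w)
        ≈⟨ *-congˡ (*-congʳ (sumTo-cong (suc (A ℕ.∸ k)) λ u _ → f≈g u)) ⟩
      e * (sumTo (suc (A ℕ.∸ k)) (λ u → g (k ℕ.+ u)) * w)
        ≈⟨ *-congˡ (*-congʳ (sym (sumTo-drop k (suc (A ℕ.∸ k)) g-low))) ⟩
      e * (sumTo (k ℕ.+ suc (A ℕ.∸ k)) g * w)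
        ≈⟨ *-congˡ (*-congʳ (reflexive (cong (λ n → sumTo n g) (≡.trans (ℕₚ.+-suc k (A ℕ.∸ k)) (cong suc (ℕₚ.m+[n∸m]≡n k≤A)))))) ⟩
      e * (sumTo (suc A) g * w)
        ≈⟨ *-congˡ (sumTo-*ʳ (suc A) w g) ⟩
      e * sumTo (suc A) (λ s → g s * w)
        ≈⟨ sumTo-*ˡ (suc A) e _ ⟩
      sumTo (suc A) (λ s → e * (g s * w))
        ≈⟨ sumTo-cong (suc A) (λ s s<sA → term s (ℕₚ.≤-pred s<sA)) ⟩
      sumTo (suc A) (λ s → outer s * inner s k) ∎
      where
      e = E (+ k ℤ.* (+ k ℤ.+ + c))
      w = G A k * G B (k ℕ.+ c)
      f g : ℕ → Carrier
      f u = E (+ u ℤ.* (+ (B ℕ.+ N) ℤ.- (+ N ℤ.- + k) ℤ.+ + u)) * (G (A ℕ.∸ k) u * Gℤ (B ℕ.+ N) (+ N ℤ.- + k ℤ.- + u))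
      g s = E ((+ s ℤ.- + k) ℤ.* (+ B ℤ.+ + s)) * (Gℤ (A ℕ.∸ k) (+ s ℤ.- + k) * Gℤ (B ℕ.+ N) (+ N ℤ.- + s))
      f≈g : ∀ u → f u ≈ g (k ℕ.+ u)
      f≈g u = *-cong (E-≡ (i₁ (+ u) (+ B) (+ N) (+ k)))
                     (*-cong (reflexive (cong (Gℤ (A ℕ.∸ k)) (i₂ (+ u) (+ k)))) (reflexive (cong (Gℤ (B ℕ.+ N)) (i₃ (+ N) (+ k) (+ u)))))
        where
        i₁ : ∀ u B N k → u ℤ.* ((B ℤ.+ N) ℤ.- (N ℤ.- k) ℤ.+ u) ≡ (k ℤ.+ u ℤ.- k) ℤ.* (B ℤ.+ (k ℤ.+ u))
        i₁ = ℤS.solve-∀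
        i₂ : ∀ u k → u ≡ k ℤ.+ u ℤ.- k
        i₂ = ℤS.solve-∀
        i₃ : ∀ N k u → N ℤ.- k ℤ.- u ≡ N ℤ.- (k ℤ.+ u)
        i₃ = ℤS.solve-∀
      g-low : ∀ s → s ℕ.< k → g s ≈ 0#
      g-low s s<k with d , ≡.refl ← ℕₚ.m≤n⇒∃[o]m+o≡n s<k = x*0≈0 _ (0*y≈0 _ (Gℤ-neg _ d (i (+ s) (+ d))))
        where
        i : ∀ s d → s ℤ.- (+ 1 ℤ.+ (s ℤ.+ d)) ≡ ℤ.- (+ 1 ℤ.+ d)
        i = ℤS.solve-∀
      term : ∀ s → s ℕ.≤ A → e * (g s * w) ≈ outer s * inner s k
      term s s≤A = begin
        e * (g s * w)  ≈⟨ group _ _ _ _ _ _ ⟩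
        (e * E ((+ s ℤ.- + k) ℤ.* (+ B ℤ.+ + s))) * ((G A k * Gℤ (A ℕ.∸ k) (+ s ℤ.- + k)) * (Gℤ (B ℕ.+ N) (+ N ℤ.- + s) * G B (k ℕ.+ c)))
          ≈⟨ *-cong (trans (sym (E-+ _ _)) (E-* (i (+ s) (+ k) (+ B) (+ c)))) (*-congʳ (G-revision k≤A s≤A)) ⟩
        (E (+ s ℤ.* (+ s ℤ.+ + c)) * E ((+ s ℤ.- + k) ℤ.* (+ B ℤ.- + k ℤ.- + c))) * ((G A s * G s k) * (Gℤ (B ℕ.+ N) (+ N ℤ.- + s) * G B (k ℕ.+ c)))
          ≈⟨ regroup _ _ _ _ _ _ ⟩
        outer s * inner s k ∎
        where
        i : ∀ s k B c → k ℤ.* (k ℤ.+ c) ℤ.+ (s ℤ.- k) ℤ.* (B ℤ.+ s) ≡ s ℤ.* (s ℤ.+ c) ℤ.+ (s ℤ.- k) ℤ.* (B ℤ.- k ℤ.- c)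
        i = ℤS.solve-∀
        group : ∀ e x y z a b → e * ((x * (y * z)) * (a * b)) ≈ (e * x) * ((a * y) * (z * b))
        group = solve 6 (λ e x y z a b → e :* ((x :* (y :* z)) :* (a :* b)) := (e :* x) :* ((a :* y) :* (z :* b))) refl
        regroup : ∀ x y a b d f → (x * y) * ((a * b) * (d * f)) ≈ (x * (a * d)) * (y * (b * f))
        regroup = solve 6 (λ x y a b d f → (x :* y) :* ((a :* b) :* (d :* f)) := (x :* (a :* d)) :* (y :* (b :* f))) refl

    -- Under u = s - k this is the Vandermonde sum for [s+B; s+c].
    inner-sum : ∀ s → s ℕ.≤ A → sumTo (suc A) (inner s) ≈ G (s ℕ.+ B) (s ℕ.+ c)
    inner-sum s s≤A = begin
      sumTo (suc A) (inner s)
        ≈⟨ sumTo-trunc (s≤s s≤A) (λ k s<k → x*0≈0 _ (0*y≈0 _ (G-above s<k))) ⟩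
      sumTo (suc s) (inner s)
        ≈⟨ sumTo-reverse s (inner s) ⟩
      sumTo (suc s) (λ u → inner s (s ℕ.∸ u))
        ≈⟨ sumTo-cong (suc s) (λ u u<ss → term u (ℕₚ.m≤n⇒∃[o]m+o≡n (ℕₚ.≤-pred u<ss))) ⟩
      sumTo (suc s) (λ u → E (+ u ℤ.* (+ B ℤ.- + (s ℕ.+ c) ℤ.+ + u)) * (G s u * Gℤ B (+ (s ℕ.+ c) ℤ.- + u)))
        ≈⟨ q-Vandermonde s B (+ (s ℕ.+ c)) ℕₚ.≤-refl ⟩
      G (s ℕ.+ B) (s ℕ.+ c) ∎
      where
      term : ∀ u → ∃ (λ v → u ℕ.+ v ≡ s) →
        inner s (s ℕ.∸ u) ≈ E (+ u ℤ.* (+ B ℤ.- + (s ℕ.+ c) ℤ.+ + u)) * (G s u * Gℤ B (+ (s ℕ.+ c) ℤ.- + u))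
      term u (v , ≡.refl) rewrite ℕₚ.m+n∸m≡n u v =
        *-cong (E-≡ (i₁ (+ u) (+ v) (+ B) (+ c))) (*-cong (sym (G-sym u v)) (reflexive (cong (Gℤ B) (i₂ (+ u) (+ v) (+ c)))))
        where
        i₁ : ∀ u v B c → (u ℤ.+ v ℤ.- v) ℤ.* (B ℤ.- v ℤ.- c) ≡ u ℤ.* (B ℤ.- (u ℤ.+ v ℤ.+ c) ℤ.+ u)
        i₁ = ℤS.solve-∀
        i₂ : ∀ u v c → v ℤ.+ c ≡ u ℤ.+ v ℤ.+ c ℤ.- u
        i₂ = ℤS.solve-∀

    -- Moves the dependence on s into one binomial, so that a factor independent of s comes out. For
    -- s ≤ N and c ≤ B it is a multinomial identity with parts N-s, s+c, B-c; otherwise both sides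
    -- vanish.
    top : ∀ s → Gℤ (B ℕ.+ N) (+ N ℤ.- + s) * G (s ℕ.+ B) (s ℕ.+ c) ≈ Gℤ (N ℕ.+ c) (+ N ℤ.- + s) * G (B ℕ.+ N) (N ℕ.+ c)
    top s with s ℕ.≤? N
    ... | no s≰N with d , ≡.refl ← ℕₚ.m≤n⇒∃[o]m+o≡n (ℕₚ.≰⇒> s≰N) =
      trans (0*y≈0 _ (Gℤ-neg _ d (i (+ N) (+ d)))) (sym (0*y≈0 _ (Gℤ-neg _ d (i (+ N) (+ d)))))
      where
      i : ∀ s d → s ℤ.- (+ 1 ℤ.+ (s ℤ.+ d)) ≡ ℤ.- (+ 1 ℤ.+ d)
      i = ℤS.solve-∀
    ... | yes s≤N with v , ≡.refl ← ℕₚ.m≤n⇒∃[o]m+o≡n s≤N with c ℕ.≤? B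
    ... | no c≰B = trans (x*0≈0 _ (G-above (ℕₚ.+-monoʳ-< s (ℕₚ.≰⇒> c≰B))))
                     (sym (x*0≈0 _ (G-above (≡.subst (ℕ._< N ℕ.+ c) (ℕₚ.+-comm N B) (ℕₚ.+-monoʳ-< N (ℕₚ.≰⇒> c≰B))))))
    ... | yes c≤B with k , ≡.refl ← ℕₚ.m≤n⇒∃[o]m+o≡n c≤B = begin
      Gℤ (B ℕ.+ N) (+ N ℤ.- + s) * G (s ℕ.+ B) (s ℕ.+ c)   ≈⟨ *-congʳ (reflexive (cong (Gℤ (B ℕ.+ N)) (i (+ s) (+ v)))) ⟩
      G (B ℕ.+ N) v * G (s ℕ.+ B) (s ℕ.+ c)                ≈⟨ G-trinomial v (s ℕ.+ c) k (n₁ B s v) (n₂ s c k) (n₃ s v c) ⟩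
      G (B ℕ.+ N) (N ℕ.+ c) * G (N ℕ.+ c) v                ≈⟨ *-comm _ _ ⟩
      G (N ℕ.+ c) v * G (B ℕ.+ N) (N ℕ.+ c)                ≈⟨ *-congʳ (reflexive (cong (Gℤ (N ℕ.+ c)) (i (+ s) (+ v)))) ⟨
      Gℤ (N ℕ.+ c) (+ N ℤ.- + s) * G (B ℕ.+ N) (N ℕ.+ c)   ∎
      where
      i : ∀ s v → s ℤ.+ v ℤ.- s ≡ v
      i = ℤS.solve-∀
      n₁ : ∀ B s v → B ℕ.+ (s ℕ.+ v) ≡ v ℕ.+ (s ℕ.+ B)
      n₁ = ℕS.solve-∀
      n₂ : ∀ s c k → s ℕ.+ (c ℕ.+ k) ≡ s ℕ.+ c ℕ.+ k
      n₂ = ℕS.solve-∀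
      n₃ : ∀ s v c → s ℕ.+ v ℕ.+ c ≡ v ℕ.+ (s ℕ.+ c)
      n₃ = ℕS.solve-∀

    final : ∀ s → outer s * G (s ℕ.+ B) (s ℕ.+ c) ≈
      (E (+ s ℤ.* (+ (N ℕ.+ c) ℤ.- + N ℤ.+ + s)) * (G A s * Gℤ (N ℕ.+ c) (+ N ℤ.- + s))) * G (B ℕ.+ N) (N ℕ.+ c)
    final s = begin
      (E (+ s ℤ.* (+ s ℤ.+ + c)) * (G A s * Gℤ (B ℕ.+ N) (+ N ℤ.- + s))) * G (s ℕ.+ B) (s ℕ.+ c)
        ≈⟨ assoc₄ _ _ _ _ ⟩
      E (+ s ℤ.* (+ s ℤ.+ + c)) * (G A s * (Gℤ (B ℕ.+ N) (+ N ℤ.- + s) * G (s ℕ.+ B) (s ℕ.+ c)))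
        ≈⟨ *-cong (E-≡ (i (+ s) (+ N) (+ c))) (*-congˡ (top s)) ⟩
      E (+ s ℤ.* (+ (N ℕ.+ c) ℤ.- + N ℤ.+ + s)) * (G A s * (Gℤ (N ℕ.+ c) (+ N ℤ.- + s) * G (B ℕ.+ N) (N ℕ.+ c)))
        ≈⟨ assoc₄ _ _ _ _ ⟨
      (E (+ s ℤ.* (+ (N ℕ.+ c) ℤ.- + N ℤ.+ + s)) * (G A s * Gℤ (N ℕ.+ c) (+ N ℤ.- + s))) * G (B ℕ.+ N) (N ℕ.+ c) ∎
      where
      assoc₄ : ∀ a b c d → (a * (b * c)) * d ≈ a * (b * (c * d))
      assoc₄ = solve 4 (λ a b c d → (a :* (b :* c)) :* d := a :* (b :* (c :* d))) refl
      i : ∀ s N c → s ℤ.* (s ℤ.+ c) ≡ s ℤ.* (N ℤ.+ c ℤ.- N ℤ.+ s)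
      i = ℤS.solve-∀

  -- The Burge transform

  B : ℤ → ℤ → ℤ → ℤ → Carrier
  B L M a b = Q (L ℤ.+ M ℤ.+ a ℤ.- b) (L ℤ.+ a) * Q (L ℤ.+ M ℤ.- a ℤ.+ b) (L ℤ.- a)

  B-neg : ∀ L M a b → B L M (ℤ.- a) (ℤ.- b) ≈ B L M a b
  B-neg L M a b = trans (*-cong (reflexive (cong₂ Q (i₁ L M a b) ≡.refl)) (reflexive (cong₂ Q (i₂ L M a b) (i₃ L a)))) (*-comm _ _)
    where
    i₁ : ∀ L M a b → L ℤ.+ M ℤ.+ (ℤ.- a) ℤ.- (ℤ.- b) ≡ L ℤ.+ M ℤ.- a ℤ.+ b
    i₁ = ℤS.solve-∀
    i₂ : ∀ L M a b → L ℤ.+ M ℤ.- (ℤ.- a) ℤ.+ (ℤ.- b) ≡ L ℤ.+ M ℤ.+ a ℤ.- b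
    i₂ = ℤS.solve-∀
    i₃ : ∀ L a → L ℤ.- (ℤ.- a) ≡ L ℤ.+ a
    i₃ = ℤS.solve-∀

  -- Replace each lower index by its complement and exchange the factors.
  B-swap : ∀ L M a b → B L M a b ≈ B M L b a
  B-swap L M a b = trans (*-cong (Q-sym (i₁ L M a b) (i₂ L M a b)) (Q-sym (i₃ L M a b) (i₄ L M a b))) (*-comm _ _)
    where
    i₁ : ∀ L M a b → L ℤ.+ M ℤ.+ a ℤ.- b ≡ M ℤ.+ L ℤ.- b ℤ.+ a
    i₁ = ℤS.solve-∀
    i₂ : ∀ L M a b → (L ℤ.+ a) ℤ.+ (M ℤ.- b) ≡ L ℤ.+ M ℤ.+ a ℤ.- b
    i₂ = ℤS.solve-∀
    i₃ : ∀ L M a b → L ℤ.+ M ℤ.- a ℤ.+ b ≡ M ℤ.+ L ℤ.+ b ℤ.- a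
    i₃ = ℤS.solve-∀
    i₄ : ∀ L M a b → (L ℤ.- a) ℤ.+ (M ℤ.+ b) ≡ L ℤ.+ M ℤ.- a ℤ.+ b
    i₄ = ℤS.solve-∀

  burgeTerm : ℕ → ℕ → ℤ → ℤ → ℕ → Carrier
  burgeTerm L M a b i =
    E (+ i ℤ.* + i) * (Q (+ 2 ℤ.* + L ℤ.+ + M ℤ.- + i) (+ 2 ℤ.* + L) * B (+ L ℤ.- + i) (+ i) a b)

  -- This and the next two bounds leave only b ≤ i ≤ min(L-a, M): outside, one of the three
  -- binomials has its lower index negative or above its top.
  burgeTerm-low : ∀ L M a b i → i ℕ.< b → burgeTerm L M (+ a) (+ b) i ≈ 0#
  burgeTerm-low L M a b i i<b with d , ≡.refl ← ℕₚ.m≤n⇒∃[o]m+o≡n i<b =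
    x*0≈0 _ (x*0≈0 _ (0*y≈0 _ (Q-above d (j (+ L) (+ i) (+ a) (+ d)))))
    where
    j : ∀ L i a d → L ℤ.- i ℤ.+ a ≡ (L ℤ.- i ℤ.+ i ℤ.+ a ℤ.- (+ 1 ℤ.+ (i ℤ.+ d))) ℤ.+ (+ 1 ℤ.+ d)
    j = ℤS.solve-∀

  burgeTerm-high : ∀ L M a b i → L ℕ.< i ℕ.+ a → burgeTerm L M (+ a) (+ b) i ≈ 0#
  burgeTerm-high L M a b i L<i+a with d , eq ← ℕₚ.m≤n⇒∃[o]m+o≡n L<i+a =
    x*0≈0 _ (x*0≈0 _ (x*0≈0 _ (Q-neg d (≡.trans (j₁ (+ L) (+ i) (+ a)) (≡.trans (cong (λ x → + L ℤ.- + x) (≡.sym eq)) (j₂ (+ L) (+ d)))))))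
    where
    j₁ : ∀ L i a → L ℤ.- i ℤ.- a ≡ L ℤ.- (i ℤ.+ a)
    j₁ = ℤS.solve-∀
    j₂ : ∀ L d → L ℤ.- (+ 1 ℤ.+ (L ℤ.+ d)) ≡ ℤ.- (+ 1 ℤ.+ d)
    j₂ = ℤS.solve-∀

  burgeTerm-wide : ∀ L M a b i → M ℕ.< i → burgeTerm L M a b i ≈ 0#
  burgeTerm-wide L M a b i M<i with d , ≡.refl ← ℕₚ.m≤n⇒∃[o]m+o≡n M<i =
    x*0≈0 _ (0*y≈0 _ (Q-above d (j (+ L) (+ M) (+ d))))
    where
    j : ∀ L M d → + 2 ℤ.* L ≡ (+ 2 ℤ.* L ℤ.+ M ℤ.- (+ 1 ℤ.+ (M ℤ.+ d))) ℤ.+ (+ 1 ℤ.+ d)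
    j = ℤS.solve-∀

  -- With i = b + k this is the Saalschütz sum for A = L+a-b, B = L-a+b, c = 2b and N = M-b; the
  -- exponent splits as (b+k)² = b² + k(k+2b). Parametrizing L and M by l and N makes these
  -- differences sums.
  burge-main : ∀ a b l N → let L = b ℕ.+ (a ℕ.+ l) ; M = b ℕ.+ N in
    sumTo (suc L) (burgeTerm L M (+ a) (+ b)) ≈ E (+ b ℤ.* + b) * B (+ L) (+ M) (+ a ℤ.+ + b) (+ b)
  burge-main a b l N = begin
    sumTo (suc L) f                      ≈⟨ reflexive (cong (λ n → sumTo n f) (≡.sym (ℕₚ.+-suc b (a ℕ.+ l)))) ⟩
    sumTo (b ℕ.+ suc (a ℕ.+ l)) f        ≈⟨ sumTo-drop b (suc (a ℕ.+ l)) (burgeTerm-low L M a b) ⟩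
    sumTo (suc (a ℕ.+ l)) (f ∘ (b ℕ.+_)) ≈⟨ sumTo-trunc (s≤s (ℕₚ.m≤n+m l a)) (λ k l<k → burgeTerm-high L M a b (b ℕ.+ k) (high k l<k)) ⟩
    sumTo (suc l) (f ∘ (b ℕ.+_))         ≈⟨ sumTo-cong (suc l) (λ k k<sl → term k (ℕₚ.m≤n⇒∃[o]m+o≡n (ℕₚ.≤-pred k<sl))) ⟩
    sumTo (suc l) (λ k → E (+ b ℤ.* + b) * g k) ≈⟨ sumTo-*ˡ (suc l) _ g ⟨
    -- Since `B′` is c + l, `G B′ (k + c)` vanishes for k > l, and the range may grow to what the
    -- Saalschütz sum asks for.
    E (+ b ℤ.* + b) * sumTo (suc l) g    ≈⟨ *-congˡ (sumTo-trunc (s≤s (ℕₚ.≤-trans (ℕₚ.m≤n+m l a) (ℕₚ.m≤n+m (a ℕ.+ l) a))) (λ k l<k → x*0≈0 _ (x*0≈0 _ (x*0≈0 _ (G-above (above k l<k)))))) ⟨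
    E (+ b ℤ.* + b) * sumTo (suc A) g    ≈⟨ *-congˡ (q-Saalschütz A B′ N c) ⟩
    E (+ b ℤ.* + b) * (G (A ℕ.+ (N ℕ.+ c)) N * G (B′ ℕ.+ N) (N ℕ.+ c))
      ≈⟨ *-congˡ (*-cong (Q≈Gℤ (A ℕ.+ (N ℕ.+ c)) (+ N) (r₁ (+ a) (+ b) (+ l) (+ N)) (r₂ (+ a) (+ b) (+ l) (+ N)))
                         (Q≈Gℤ (B′ ℕ.+ N) (+ (N ℕ.+ c)) (r₃ (+ a) (+ b) (+ l) (+ N)) (r₄ (+ a) (+ b) (+ l) (+ N)))) ⟨
    E (+ b ℤ.* + b) * B (+ L) (+ M) (+ a ℤ.+ + b) (+ b) ∎
    where
    L = b ℕ.+ (a ℕ.+ l)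
    M = b ℕ.+ N
    A = a ℕ.+ (a ℕ.+ l)
    B′ = b ℕ.+ b ℕ.+ l
    c = b ℕ.+ b
    f = burgeTerm L M (+ a) (+ b)
    g : ℕ → Carrier
    g k = E (+ k ℤ.* (+ k ℤ.+ + c)) * (Gℤ (A ℕ.∸ k ℕ.+ (B′ ℕ.+ N)) (+ N ℤ.- + k) * (G A k * G B′ (k ℕ.+ c)))
    high : ∀ k → l ℕ.< k → L ℕ.< b ℕ.+ k ℕ.+ a
    high k l<k = ≡.subst (L ℕ.<_) (i b k a) (ℕₚ.+-monoʳ-< b (ℕₚ.+-monoʳ-< a l<k))
      where
      i : ∀ b k a → b ℕ.+ (a ℕ.+ k) ≡ b ℕ.+ k ℕ.+ a
      i = ℕS.solve-∀
    above : ∀ k → l ℕ.< k → B′ ℕ.< k ℕ.+ c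
    above k l<k = ≡.subst (B′ ℕ.<_) (ℕₚ.+-comm c k) (ℕₚ.+-monoʳ-< c l<k)
    r₁ : ∀ a b l N → (b ℤ.+ (a ℤ.+ l)) ℤ.+ (b ℤ.+ N) ℤ.+ (a ℤ.+ b) ℤ.- b ≡ a ℤ.+ (a ℤ.+ l) ℤ.+ (N ℤ.+ (b ℤ.+ b))
    r₁ = ℤS.solve-∀
    r₂ : ∀ a b l N → (b ℤ.+ (a ℤ.+ l)) ℤ.+ (a ℤ.+ b) ℤ.+ N ≡ a ℤ.+ (a ℤ.+ l) ℤ.+ (N ℤ.+ (b ℤ.+ b))
    r₂ = ℤS.solve-∀
    r₃ : ∀ a b l N → (b ℤ.+ (a ℤ.+ l)) ℤ.+ (b ℤ.+ N) ℤ.- (a ℤ.+ b) ℤ.+ b ≡ b ℤ.+ b ℤ.+ l ℤ.+ N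
    r₃ = ℤS.solve-∀
    r₄ : ∀ a b l N → (b ℤ.+ (a ℤ.+ l)) ℤ.- (a ℤ.+ b) ℤ.+ (N ℤ.+ (b ℤ.+ b)) ≡ b ℤ.+ b ℤ.+ l ℤ.+ N
    r₄ = ℤS.solve-∀
    term : ∀ k → ∃ (λ v → k ℕ.+ v ≡ l) → f (b ℕ.+ k) ≈ E (+ b ℤ.* + b) * g k
    term k (v , ≡.refl) = begin
      f (b ℕ.+ k)
        ≈⟨ *-cong (E-* (e (+ b) (+ k)))
             (*-cong (Q≈Gℤ (A ℕ.∸ k ℕ.+ (B′ ℕ.+ N)) (+ N ℤ.- + k)
                       (≡.trans (t₁ (+ a) (+ b) (+ k) (+ v) (+ N)) (cong +_ A∸k)) (≡.trans (t₂ (+ a) (+ b) (+ k) (+ v) (+ N)) (cong +_ A∸k)))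
                     (*-cong (Q≈Gℤ A (+ k) (t₃ (+ a) (+ b) (+ k) (+ v)) (t₄ (+ a) (+ b) (+ k) (+ v)))
                             (Q≈Gℤ B′ (+ (k ℕ.+ c)) (t₅ (+ a) (+ b) (+ k) (+ v)) (t₆ (+ a) (+ b) (+ k) (+ v))))) ⟩
      (E (+ b ℤ.* + b) * E (+ k ℤ.* (+ k ℤ.+ + c))) * (Gℤ (A ℕ.∸ k ℕ.+ (B′ ℕ.+ N)) (+ N ℤ.- + k) * (G A k * G B′ (k ℕ.+ c)))
        ≈⟨ *-assoc _ _ _ ⟩
      E (+ b ℤ.* + b) * g k ∎
      where
      A∸k : a ℕ.+ (a ℕ.+ v) ℕ.+ (B′ ℕ.+ N) ≡ A ℕ.∸ k ℕ.+ (B′ ℕ.+ N)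
      A∸k = cong (ℕ._+ (B′ ℕ.+ N)) (≡.sym (≡.trans (cong (ℕ._∸ k) (j a k v)) (ℕₚ.m+n∸m≡n k (a ℕ.+ (a ℕ.+ v)))))
        where
        j : ∀ a k v → a ℕ.+ (a ℕ.+ (k ℕ.+ v)) ≡ k ℕ.+ (a ℕ.+ (a ℕ.+ v))
        j = ℕS.solve-∀
      e : ∀ b k → (b ℤ.+ k) ℤ.* (b ℤ.+ k) ≡ b ℤ.* b ℤ.+ k ℤ.* (k ℤ.+ (b ℤ.+ b))
      e = ℤS.solve-∀
      t₁ : ∀ a b k v N → + 2 ℤ.* (b ℤ.+ (a ℤ.+ (k ℤ.+ v))) ℤ.+ (b ℤ.+ N) ℤ.- (b ℤ.+ k) ≡ a ℤ.+ (a ℤ.+ v) ℤ.+ (b ℤ.+ b ℤ.+ (k ℤ.+ v) ℤ.+ N)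
      t₁ = ℤS.solve-∀
      t₂ : ∀ a b k v N → + 2 ℤ.* (b ℤ.+ (a ℤ.+ (k ℤ.+ v))) ℤ.+ (N ℤ.- k) ≡ a ℤ.+ (a ℤ.+ v) ℤ.+ (b ℤ.+ b ℤ.+ (k ℤ.+ v) ℤ.+ N)
      t₂ = ℤS.solve-∀
      t₃ : ∀ a b k v → (b ℤ.+ (a ℤ.+ (k ℤ.+ v))) ℤ.- (b ℤ.+ k) ℤ.+ (b ℤ.+ k) ℤ.+ a ℤ.- b ≡ a ℤ.+ (a ℤ.+ (k ℤ.+ v))
      t₃ = ℤS.solve-∀
      t₄ : ∀ a b k v → (b ℤ.+ (a ℤ.+ (k ℤ.+ v))) ℤ.- (b ℤ.+ k) ℤ.+ a ℤ.+ k ≡ a ℤ.+ (a ℤ.+ (k ℤ.+ v))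
      t₄ = ℤS.solve-∀
      t₅ : ∀ a b k v → (b ℤ.+ (a ℤ.+ (k ℤ.+ v))) ℤ.- (b ℤ.+ k) ℤ.+ (b ℤ.+ k) ℤ.- a ℤ.+ b ≡ b ℤ.+ b ℤ.+ (k ℤ.+ v)
      t₅ = ℤS.solve-∀
      t₆ : ∀ a b k v → (b ℤ.+ (a ℤ.+ (k ℤ.+ v))) ℤ.- (b ℤ.+ k) ℤ.- a ℤ.+ (k ℤ.+ (b ℤ.+ b)) ≡ b ℤ.+ b ℤ.+ (k ℤ.+ v)
      t₆ = ℤS.solve-∀

  -- If a + b > L or b > M, every term on the left vanishes, and so does a binomial on the right.
  burge : ∀ L M a b → sumTo (suc L) (burgeTerm L M (+ a) (+ b)) ≈ E (+ b ℤ.* + b) * B (+ L) (+ M) (+ a ℤ.+ + b) (+ b)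
  burge L M a b with b ℕ.+ a ℕ.≤? L | b ℕ.≤? M
  ... | yes b+a≤L | yes b≤M with l , ≡.refl ← ℕₚ.m≤n⇒∃[o]m+o≡n b+a≤L with N , ≡.refl ← ℕₚ.m≤n⇒∃[o]m+o≡n b≤M
    rewrite ℕₚ.+-assoc b a l = burge-main a b l N
  burge L M a b | no b+a≰L | _ = trans (sumTo-0 (suc L) left) (sym (x*0≈0 _ (x*0≈0 _ right)))
    where
    left : ∀ i → i ℕ.< suc L → burgeTerm L M (+ a) (+ b) i ≈ 0#
    left i _ with i ℕ.<? b
    ... | yes i<b = burgeTerm-low L M a b i i<b
    ... | no i≮b = burgeTerm-high L M a b i (ℕₚ.<-≤-trans (ℕₚ.≰⇒> b+a≰L) (ℕₚ.+-monoˡ-≤ a (ℕₚ.≮⇒≥ i≮b)))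
    right : Q (+ L ℤ.+ + M ℤ.- (+ a ℤ.+ + b) ℤ.+ + b) (+ L ℤ.- (+ a ℤ.+ + b)) ≈ 0#
    right with d , eq ← ℕₚ.m≤n⇒∃[o]m+o≡n (ℕₚ.≰⇒> b+a≰L) =
      Q-neg d (≡.trans (cong (λ x → + L ℤ.- x) (≡.trans (ℤₚ.+-comm (+ a) (+ b)) (cong +_ (≡.sym eq)))) (j (+ L) (+ d)))
      where
      j : ∀ L d → L ℤ.- (+ 1 ℤ.+ (L ℤ.+ d)) ≡ ℤ.- (+ 1 ℤ.+ d)
      j = ℤS.solve-∀
  burge L M a b | yes _ | no b≰M = trans (sumTo-0 (suc L) left) (sym (x*0≈0 _ (0*y≈0 _ right)))
    where
    left : ∀ i → i ℕ.< suc L → burgeTerm L M (+ a) (+ b) i ≈ 0#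
    left i _ with i ℕ.<? b
    ... | yes i<b = burgeTerm-low L M a b i i<b
    ... | no i≮b = burgeTerm-wide L M (+ a) (+ b) i (ℕₚ.<-≤-trans (ℕₚ.≰⇒> b≰M) (ℕₚ.≮⇒≥ i≮b))
    right : Q (+ L ℤ.+ + M ℤ.+ (+ a ℤ.+ + b) ℤ.- + b) (+ L ℤ.+ (+ a ℤ.+ + b)) ≈ 0#
    right with d , ≡.refl ← ℕₚ.m≤n⇒∃[o]m+o≡n (ℕₚ.≰⇒> b≰M) = Q-above d (j (+ L) (+ M) (+ a) (+ d))
      where
      j : ∀ L M a d → L ℤ.+ (a ℤ.+ (+ 1 ℤ.+ (M ℤ.+ d))) ≡ (L ℤ.+ M ℤ.+ (a ℤ.+ (+ 1 ℤ.+ (M ℤ.+ d))) ℤ.- (+ 1 ℤ.+ (M ℤ.+ d))) ℤ.+ (+ 1 ℤ.+ d)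
      j = ℤS.solve-∀

  -- The arguments a j and b j share the sign of j, so negative j reduce to positive ones by
  -- negating both.
  burge-ℤ : ∀ L M a b j →
    sumTo (suc L) (burgeTerm L M (+ a ℤ.* j) (+ b ℤ.* j))
      ≈ E (+ b ℤ.* + b ℤ.* (j ℤ.* j)) * B (+ L) (+ M) ((+ a ℤ.+ + b) ℤ.* j) (+ b ℤ.* j)
  burge-ℤ L M a b (+ n) = begin
    sumTo (suc L) (burgeTerm L M (+ a ℤ.* + n) (+ b ℤ.* + n))
      ≈⟨ reflexive (cong₂ (λ x y → sumTo (suc L) (burgeTerm L M x y)) (≡.sym (ℤₚ.pos-* a n)) (≡.sym (ℤₚ.pos-* b n))) ⟩
    sumTo (suc L) (burgeTerm L M (+ (a ℕ.* n)) (+ (b ℕ.* n)))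
      ≈⟨ burge L M (a ℕ.* n) (b ℕ.* n) ⟩
    E (+ (b ℕ.* n) ℤ.* + (b ℕ.* n)) * B (+ L) (+ M) (+ (a ℕ.* n) ℤ.+ + (b ℕ.* n)) (+ (b ℕ.* n))
      ≈⟨ reflexive (cong₂ (λ x y → E (y ℤ.* y) * B (+ L) (+ M) (x ℤ.+ y) y) (ℤₚ.pos-* a n) (ℤₚ.pos-* b n)) ⟩
    E (+ b ℤ.* + n ℤ.* (+ b ℤ.* + n)) * B (+ L) (+ M) (+ a ℤ.* + n ℤ.+ + b ℤ.* + n) (+ b ℤ.* + n)
      ≈⟨ reflexive (cong₂ (λ x y → E x * B (+ L) (+ M) y (+ b ℤ.* + n)) (e (+ b) (+ n)) (≡.sym (ℤₚ.*-distribʳ-+ (+ n) (+ a) (+ b)))) ⟩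
    E (+ b ℤ.* + b ℤ.* (+ n ℤ.* + n)) * B (+ L) (+ M) ((+ a ℤ.+ + b) ℤ.* + n) (+ b ℤ.* + n) ∎
    where
    e : ∀ b n → b ℤ.* n ℤ.* (b ℤ.* n) ≡ b ℤ.* b ℤ.* (n ℤ.* n)
    e = ℤS.solve-∀
  burge-ℤ L M a b j@(-[1+ n ]) = begin
    sumTo (suc L) (burgeTerm L M (+ a ℤ.* j) (+ b ℤ.* j))
      ≈⟨ reflexive (cong₂ (λ x y → sumTo (suc L) (burgeTerm L M x y)) (neg (+ a)) (neg (+ b))) ⟩
    sumTo (suc L) (burgeTerm L M (ℤ.- (+ a ℤ.* + suc n)) (ℤ.- (+ b ℤ.* + suc n)))
      ≈⟨ sumTo-cong (suc L) (λ i _ → *-congˡ (*-congˡ (B-neg (+ L ℤ.- + i) (+ i) (+ a ℤ.* + suc n) (+ b ℤ.* + suc n)))) ⟩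
    sumTo (suc L) (burgeTerm L M (+ a ℤ.* + suc n) (+ b ℤ.* + suc n))
      ≈⟨ burge-ℤ L M a b (+ suc n) ⟩
    E (+ b ℤ.* + b ℤ.* (j ℤ.* j)) * B (+ L) (+ M) ((+ a ℤ.+ + b) ℤ.* + suc n) (+ b ℤ.* + suc n)
      ≈⟨ *-congˡ (B-neg (+ L) (+ M) ((+ a ℤ.+ + b) ℤ.* + suc n) (+ b ℤ.* + suc n)) ⟨
    E (+ b ℤ.* + b ℤ.* (j ℤ.* j)) * B (+ L) (+ M) (ℤ.- ((+ a ℤ.+ + b) ℤ.* + suc n)) (ℤ.- (+ b ℤ.* + suc n))
      ≈⟨ *-congˡ (reflexive (cong₂ (B (+ L) (+ M)) (neg (+ a ℤ.+ + b)) (neg (+ b)))) ⟨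
    E (+ b ℤ.* + b ℤ.* (j ℤ.* j)) * B (+ L) (+ M) ((+ a ℤ.+ + b) ℤ.* j) (+ b ℤ.* j) ∎
    where
    neg : ∀ x → x ℤ.* -[1+ n ] ≡ ℤ.- (x ℤ.* + suc n)
    neg x = ≡.sym (ℤₚ.neg-distribʳ-* x (+ suc n))

  -- The case (a,b) = (1,1)

  sgn : ℤ → Carrier
  sgn j = ε ℤ.∣ j ∣
    where
    ε : ℕ → Carrier
    ε zero    = 1#
    ε (suc n) = - ε n

  triangular : ℕ → ℤ
  triangular zero    = + 0
  triangular (suc n) = triangular n ℤ.+ + suc n

  -- j(j+1)/2
  T : ℤ → ℤ
  T (+ n)    = triangular n
  T -[1+ n ] = triangular n

  -- Both halves of Pascal's rule for [2r; r+j] give sums that cancel in pairs, under j ↔ -1-j and j ↔ 1-j.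
  alternating-sum-vanishes : ∀ r K → suc r ℕ.≤ K →
    sumℤ± K (λ j → sgn j * (E (T j) * Gℤ (2 ℕ.* suc r) (+ suc r ℤ.+ j))) ≈ 0#
  alternating-sum-vanishes r K r<K = begin
    sumℤ± K (λ j → sgn j * (E (T j) * Gℤ (2 ℕ.* suc r) (+ suc r ℤ.+ j)))
      ≈⟨ sumℤ±-cong K (λ j → split j) ⟩
    sumℤ± K (λ j → f j + g j)
      ≈⟨ sumℤ±-+ K f g ⟩
    sumℤ± K f + sumℤ± K g
      ≈⟨ +-cong (trans (sumℤ±-antisym₋₁ K f f-antisym) f-end)
                (trans (sumℤ±-antisym₁ K g g-antisym₀ g-antisym) (trans (-‿cong g-end) -0#≈0#)) ⟩
    0# + 0#
      ≈⟨ +-identityˡ _ ⟩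
    0# ∎
    where
    -- n is 2r+1, written as the predecessor of `2 * suc r` after unfolding. Being the sum of r+1+j
    -- and r-j, it makes the binomial in `f` symmetric under j ↔ -1-j.
    n = r ℕ.+ suc (r ℕ.+ 0)
    +n : + n ≡ + r ℤ.+ (+ 1 ℤ.+ + r)
    +n = cong (λ x → + (r ℕ.+ suc x)) (ℕₚ.+-identityʳ r)
    f g : ℤ → Carrier
    f j = sgn j * (E (T j) * Gℤ n (+ suc r ℤ.+ j))
    -- T j - j is j(j-1)/2, which is invariant under j ↔ 1-j, and so is [2r+1; r+j].
    g j = sgn j * (E (T j ℤ.+ (+ suc r ℤ.- j)) * Gℤ n (+ r ℤ.+ j))
    split : ∀ j → sgn j * (E (T j) * Gℤ (suc n) (+ suc r ℤ.+ j)) ≈ f j + g j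
    split j = begin
      sgn j * (E (T j) * Gℤ (suc n) (+ suc r ℤ.+ j))
        ≈⟨ *-congˡ (*-congˡ (Gℤ-pascalʳ n (+ suc r ℤ.+ j))) ⟩
      sgn j * (E (T j) * (Gℤ n (+ suc r ℤ.+ j) + E (+ suc n ℤ.- (+ suc r ℤ.+ j)) * Gℤ n (+ suc r ℤ.+ j ℤ.- + 1)))
        ≈⟨ expand _ _ _ _ _ ⟩
      f j + sgn j * (E (T j) * E (+ suc n ℤ.- (+ suc r ℤ.+ j)) * Gℤ n (+ suc r ℤ.+ j ℤ.- + 1))
        ≈⟨ +-congˡ (*-congˡ (*-cong (trans (sym (E-+ _ _)) (E-≡ (cong (λ x → T j ℤ.+ x)
              (≡.trans (cong (λ x → + 1 ℤ.+ x ℤ.- (+ suc r ℤ.+ j)) +n) (i₁ (+ r) j)))))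
             (reflexive (cong (Gℤ n) (i₂ (+ r) j))))) ⟩
      f j + g j ∎
      where
      expand : ∀ a b x y z → a * (b * (x + y * z)) ≈ a * (b * x) + a * (b * y * z)
      expand = solve 5 (λ a b x y z → a :* (b :* (x :+ y :* z)) := a :* (b :* x) :+ a :* (b :* y :* z)) refl
      i₁ : ∀ r j → + 1 ℤ.+ (r ℤ.+ (+ 1 ℤ.+ r)) ℤ.- (+ 1 ℤ.+ r ℤ.+ j) ≡ + 1 ℤ.+ r ℤ.- j
      i₁ = ℤS.solve-∀
      i₂ : ∀ r j → + 1 ℤ.+ r ℤ.+ j ℤ.- + 1 ≡ r ℤ.+ j
      i₂ = ℤS.solve-∀
    f-antisym : ∀ j → f -[1+ j ] ≈ - f (+ j)
    f-antisym j = trans (*-congˡ (*-congˡ (Gℤ-sym n { + suc r ℤ.+ -[1+ j ]} { + suc r ℤ.+ + j} (≡.trans (i (+ r) (+ j)) (≡.sym +n)))))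
                        (sym (-‿distribˡ-* _ _))
      where
      i : ∀ r j → (+ 1 ℤ.+ r) ℤ.+ ℤ.- (+ 1 ℤ.+ j) ℤ.+ ((+ 1 ℤ.+ r) ℤ.+ j) ≡ r ℤ.+ (+ 1 ℤ.+ r)
      i = ℤS.solve-∀
    vanish : ∀ k → r ℕ.+ suc r ℕ.≤ k → Gℤ n (+ suc k) ≈ 0#
    vanish k p = G-above (s≤s (≡.subst (ℕ._≤ k) (≡.sym (ℤₚ.+-injective +n)) p))
    f-end : f (+ K) ≈ 0#
    f-end = x*0≈0 _ (x*0≈0 _ (vanish (r ℕ.+ K) (ℕₚ.+-monoʳ-≤ r r<K)))
    g-end : g (+ suc K) ≈ 0#
    g-end = x*0≈0 _ (x*0≈0 _ (trans (reflexive (cong (Gℤ n ∘ +_) (ℕₚ.+-suc r K))) (vanish (r ℕ.+ K) (ℕₚ.+-monoʳ-≤ r r<K))))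
    g-antisym₀ : g (+ 0) ≈ - g (+ 1)
    g-antisym₀ = begin
      1# * (E (+ 0 ℤ.+ (+ suc r ℤ.- + 0)) * Gℤ n (+ r ℤ.+ + 0))
        ≈⟨ *-congˡ (*-cong (E-≡ (i₁ (+ r))) (Gℤ-sym n { + r ℤ.+ + 0} { + r ℤ.+ + 1} (≡.trans (i₂ (+ r)) (≡.sym +n)))) ⟩
      1# * (E (+ 1 ℤ.+ (+ suc r ℤ.- + 1)) * Gℤ n (+ r ℤ.+ + 1))
        ≈⟨ -‿involutive _ ⟨
      - - (1# * (E (+ 1 ℤ.+ (+ suc r ℤ.- + 1)) * Gℤ n (+ r ℤ.+ + 1)))
        ≈⟨ -‿cong (-‿distribˡ-* _ _) ⟩
      - (- 1# * (E (+ 1 ℤ.+ (+ suc r ℤ.- + 1)) * Gℤ n (+ r ℤ.+ + 1))) ∎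
      where
      i₁ : ∀ r → + 0 ℤ.+ (+ 1 ℤ.+ r ℤ.- + 0) ≡ + 1 ℤ.+ (+ 1 ℤ.+ r ℤ.- + 1)
      i₁ = ℤS.solve-∀
      i₂ : ∀ r → r ℤ.+ + 0 ℤ.+ (r ℤ.+ + 1) ≡ r ℤ.+ (+ 1 ℤ.+ r)
      i₂ = ℤS.solve-∀
    g-antisym : ∀ j → g -[1+ j ] ≈ - g (+ suc (suc j))
    g-antisym j = trans (*-cong (sym (-‿involutive _)) (*-cong (E-≡ (i₁ (triangular j) (+ r) (+ j)))
                          (Gℤ-sym n { + r ℤ.+ -[1+ j ]} { + r ℤ.+ + suc (suc j)} (≡.trans (i₂ (+ r) (+ j)) (≡.sym +n)))))
                        (sym (-‿distribˡ-* _ _))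
      where
      i₁ : ∀ t r j → t ℤ.+ (+ 1 ℤ.+ r ℤ.- ℤ.- (+ 1 ℤ.+ j)) ≡
        t ℤ.+ (+ 1 ℤ.+ j) ℤ.+ (+ 2 ℤ.+ j) ℤ.+ (+ 1 ℤ.+ r ℤ.- (+ 2 ℤ.+ j))
      i₁ = ℤS.solve-∀
      i₂ : ∀ r j → r ℤ.+ ℤ.- (+ 1 ℤ.+ j) ℤ.+ (r ℤ.+ (+ 2 ℤ.+ j)) ≡ r ℤ.+ (+ 1 ℤ.+ r)
      i₂ = ℤS.solve-∀

  linearizationTerm : ℕ → ℕ → ℤ → ℕ → Carrier
  linearizationTerm L M j r =
    E (+ r ℤ.* + r ℤ.- j ℤ.* j) * (Gℤ (L ℕ.+ M) (+ L ℤ.- + r) * (G (M ℕ.+ r) (2 ℕ.* r) * Gℤ (2 ℕ.* r) (+ r ℤ.+ j)))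

  linearizationTerm-low : ∀ L M {j r} → r ℕ.< j → linearizationTerm L M (+ j) r ≈ 0#
  linearizationTerm-low L M {j} {r} r<j =
    x*0≈0 _ (x*0≈0 _ (x*0≈0 _ (G-above (≡.subst (ℕ._< r ℕ.+ j) (cong (r ℕ.+_) (≡.sym (ℕₚ.+-identityʳ r))) (ℕₚ.+-monoʳ-< r r<j)))))

  linearizationTerm-wide : ∀ L M j {r} → M ℕ.< r → linearizationTerm L M j r ≈ 0#
  linearizationTerm-wide L M j {r} M<r =
    x*0≈0 _ (x*0≈0 _ (0*y≈0 _ (G-above (≡.subst (M ℕ.+ r ℕ.<_) (cong (r ℕ.+_) (≡.sym (ℕₚ.+-identityʳ r))) (ℕₚ.+-monoˡ-< r M<r)))))

  -- Expand [L+M; L-j] by Vandermonde with parts M-j and L+j, multiply by [L+M; L+j] and regroup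
  -- twice; the summation index is s = r - j.
  linearization-main : ∀ j N A → let L = j ℕ.+ N ; M = j ℕ.+ A in
    B (+ L) (+ M) (+ j) (+ j) ≈ sumTo (suc L) (linearizationTerm L M (+ j))
  linearization-main j N A = begin
    B (+ L) (+ M) (+ j) (+ j)
      ≈⟨ *-cong (Q-at (A ℕ.+ (N ℕ.+ c)) (+ (N ℕ.+ c)) (i₁ (+ j) (+ N) (+ A)) (i₂ (+ j) (+ N)))
                (Q-at (A ℕ.+ (N ℕ.+ c)) (+ N) (i₃ (+ j) (+ N) (+ A)) (i₄ (+ j) (+ N))) ⟩
    w * G (A ℕ.+ (N ℕ.+ c)) N
      ≈⟨ *-comm _ _ ⟩
    G (A ℕ.+ (N ℕ.+ c)) N * w
      ≈⟨ *-congʳ (q-Vandermonde A (N ℕ.+ c) (+ N) (s≤s (ℕₚ.m≤m+n A N))) ⟨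
    sumTo (suc (A ℕ.+ N)) v * w
      ≈⟨ *-congʳ (sumTo-trunc (s≤s (ℕₚ.m≤n+m N A)) v-high) ⟩
    sumTo (suc N) v * w
      ≈⟨ sumTo-*ʳ (suc N) w v ⟩
    sumTo (suc N) (λ s → v s * w)
      ≈⟨ sumTo-cong (suc N) (λ s s<sN → term s (ℕₚ.m≤n⇒∃[o]m+o≡n (ℕₚ.≤-pred s<sN))) ⟩
    sumTo (suc N) (λ s → linearizationTerm L M (+ j) (j ℕ.+ s))
      ≈⟨ sumTo-drop j (suc N) (λ r r<j → linearizationTerm-low L M r<j) ⟨
    sumTo (j ℕ.+ suc N) (linearizationTerm L M (+ j))
      ≈⟨ reflexive (cong (λ n → sumTo n (linearizationTerm L M (+ j))) (ℕₚ.+-suc j N)) ⟩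
    sumTo (suc L) (linearizationTerm L M (+ j)) ∎
    where
    L = j ℕ.+ N
    M = j ℕ.+ A
    c = j ℕ.+ j
    w = G (A ℕ.+ (N ℕ.+ c)) (N ℕ.+ c)
    v : ℕ → Carrier
    v s = E (+ s ℤ.* (+ (N ℕ.+ c) ℤ.- + N ℤ.+ + s)) * (G A s * Gℤ (N ℕ.+ c) (+ N ℤ.- + s))
    v-high : ∀ s → suc N ℕ.≤ s → v s ≈ 0#
    v-high s N<s with d , ≡.refl ← ℕₚ.m≤n⇒∃[o]m+o≡n N<s = x*0≈0 _ (x*0≈0 _ (Gℤ-neg _ d (i (+ N) (+ d))))
      where
      i : ∀ s d → s ℤ.- (+ 1 ℤ.+ (s ℤ.+ d)) ≡ ℤ.- (+ 1 ℤ.+ d)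
      i = ℤS.solve-∀
    i₁ : ∀ j N A → j ℤ.+ N ℤ.+ (j ℤ.+ A) ℤ.+ j ℤ.- j ≡ A ℤ.+ (N ℤ.+ (j ℤ.+ j))
    i₁ = ℤS.solve-∀
    i₂ : ∀ j N → j ℤ.+ N ℤ.+ j ≡ N ℤ.+ (j ℤ.+ j)
    i₂ = ℤS.solve-∀
    i₃ : ∀ j N A → j ℤ.+ N ℤ.+ (j ℤ.+ A) ℤ.- j ℤ.+ j ≡ A ℤ.+ (N ℤ.+ (j ℤ.+ j))
    i₃ = ℤS.solve-∀
    i₄ : ∀ j N → j ℤ.+ N ℤ.- j ≡ N
    i₄ = ℤS.solve-∀
    term : ∀ s → ∃ (λ u → s ℕ.+ u ≡ N) → v s * w ≈ linearizationTerm L M (+ j) (j ℕ.+ s)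
    term s (u , ≡.refl) with s ℕ.≤? A
    ... | no s≰A = trans (0*y≈0 _ (x*0≈0 _ (0*y≈0 _ (G-above (ℕₚ.≰⇒> s≰A)))))
                         (sym (linearizationTerm-wide L M (+ j) (ℕₚ.+-monoʳ-< j (ℕₚ.≰⇒> s≰A))))
    ... | yes s≤A with k , ≡.refl ← ℕₚ.m≤n⇒∃[o]m+o≡n s≤A = begin
      (e * (G A s * Gℤ (N ℕ.+ c) (+ N ℤ.- + s))) * w
        ≈⟨ group _ _ _ _ ⟩
      e * (G A s * (w * Gℤ (N ℕ.+ c) (+ N ℤ.- + s)))
        ≈⟨ *-congˡ (*-congˡ (*-congˡ (reflexive (cong (Gℤ (N ℕ.+ c)) (t₁ (+ s) (+ u)))))) ⟩
      e * (G A s * (w * G (N ℕ.+ c) u))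
        -- Here L+M is split into u, s+c and A; the second regrouping splits M+r into s+c, s and k,
        -- with (s+c) + s = 2r.
        ≈⟨ *-congˡ (*-congˡ (G-trinomial u (s ℕ.+ c) A {m = s ℕ.+ c ℕ.+ A} (n₁ s u c k) ≡.refl (n₂ s u c))) ⟨
      e * (G A s * (G n u * G (s ℕ.+ c ℕ.+ A) (s ℕ.+ c)))
        ≈⟨ regroup _ _ _ _ ⟩
      e * (G n u * (G (s ℕ.+ c ℕ.+ A) (s ℕ.+ c) * G A s))
        ≈⟨ *-congˡ (*-congˡ (G-trinomial (s ℕ.+ c) s k ≡.refl ≡.refl (n₃ j s))) ⟩
      e * (G n u * (G (s ℕ.+ c ℕ.+ A) (2 ℕ.* r) * G (2 ℕ.* r) (s ℕ.+ c)))
        ≈⟨ *-cong (E-≡ (t₂ (+ s) (+ u) (+ j)))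
             (*-cong (reflexive (cong₂ Gℤ (n₄ j s u k) (t₃ (+ s) (+ u) (+ j))))
               (*-cong (reflexive (cong (λ x → G x (2 ℕ.* r)) (n₅ j s k))) (reflexive (cong (G (2 ℕ.* r)) (n₆ j s))))) ⟩
      linearizationTerm L M (+ j) r ∎
      where
      r = j ℕ.+ s
      n = A ℕ.+ (N ℕ.+ c)
      e = E (+ s ℤ.* (+ (N ℕ.+ c) ℤ.- + N ℤ.+ + s))
      group : ∀ e a x w → (e * (a * x)) * w ≈ e * (a * (w * x))
      group = solve 4 (λ e a x w → (e :* (a :* x)) :* w := e :* (a :* (w :* x))) refl
      regroup : ∀ e a b c → e * (a * (b * c)) ≈ e * (b * (c * a))
      regroup = solve 4 (λ e a b c → e :* (a :* (b :* c)) := e :* (b :* (c :* a))) refl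
      t₁ : ∀ s u → s ℤ.+ u ℤ.- s ≡ u
      t₁ = ℤS.solve-∀
      n₁ : ∀ s u c k → s ℕ.+ k ℕ.+ (s ℕ.+ u ℕ.+ c) ≡ u ℕ.+ (s ℕ.+ c ℕ.+ (s ℕ.+ k))
      n₁ = ℕS.solve-∀
      n₂ : ∀ s u c → s ℕ.+ u ℕ.+ c ≡ u ℕ.+ (s ℕ.+ c)
      n₂ = ℕS.solve-∀
      n₃ : ∀ j s → 2 ℕ.* (j ℕ.+ s) ≡ s ℕ.+ (j ℕ.+ j) ℕ.+ s
      n₃ = ℕS.solve-∀
      n₄ : ∀ j s u k → s ℕ.+ k ℕ.+ (s ℕ.+ u ℕ.+ (j ℕ.+ j)) ≡ j ℕ.+ (s ℕ.+ u) ℕ.+ (j ℕ.+ (s ℕ.+ k))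
      n₄ = ℕS.solve-∀
      n₅ : ∀ j s k → s ℕ.+ (j ℕ.+ j) ℕ.+ (s ℕ.+ k) ≡ j ℕ.+ (s ℕ.+ k) ℕ.+ (j ℕ.+ s)
      n₅ = ℕS.solve-∀
      n₆ : ∀ j s → s ℕ.+ (j ℕ.+ j) ≡ j ℕ.+ s ℕ.+ j
      n₆ = ℕS.solve-∀
      t₂ : ∀ s u j → s ℤ.* ((s ℤ.+ u ℤ.+ (j ℤ.+ j)) ℤ.- (s ℤ.+ u) ℤ.+ s) ≡ (j ℤ.+ s) ℤ.* (j ℤ.+ s) ℤ.- j ℤ.* j
      t₂ = ℤS.solve-∀
      t₃ : ∀ s u j → u ≡ j ℤ.+ (s ℤ.+ u) ℤ.- (j ℤ.+ s)
      t₃ = ℤS.solve-∀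

  linearization-ℕ : ∀ L M j → B (+ L) (+ M) (+ j) (+ j) ≈ sumTo (suc L) (linearizationTerm L M (+ j))
  linearization-ℕ L M j with j ℕ.≤? L | j ℕ.≤? M
  ... | yes j≤L | yes j≤M with N , ≡.refl ← ℕₚ.m≤n⇒∃[o]m+o≡n j≤L with A , ≡.refl ← ℕₚ.m≤n⇒∃[o]m+o≡n j≤M =
    linearization-main j N A
  ... | no j≰L | _ with d , ≡.refl ← ℕₚ.m≤n⇒∃[o]m+o≡n (ℕₚ.≰⇒> j≰L) =
    trans (x*0≈0 _ (Q-neg d (i (+ L) (+ d))))
          (sym (sumTo-0 (suc L) λ r r<sL → linearizationTerm-low L M (ℕₚ.<-≤-trans r<sL (s≤s (ℕₚ.m≤m+n L d)))))
    where
    i : ∀ s d → s ℤ.- (+ 1 ℤ.+ (s ℤ.+ d)) ≡ ℤ.- (+ 1 ℤ.+ d)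
    i = ℤS.solve-∀
  linearization-ℕ L M j | yes _ | no j≰M with d , ≡.refl ← ℕₚ.m≤n⇒∃[o]m+o≡n (ℕₚ.≰⇒> j≰M) =
    trans (0*y≈0 _ (Q-above d (i (+ L) (+ M) (+ d)))) (sym (sumTo-0 (suc L) λ r _ → right r))
    where
    i : ∀ L M d → L ℤ.+ (+ 1 ℤ.+ (M ℤ.+ d)) ≡ (L ℤ.+ M ℤ.+ (+ 1 ℤ.+ (M ℤ.+ d)) ℤ.- (+ 1 ℤ.+ (M ℤ.+ d))) ℤ.+ (+ 1 ℤ.+ d)
    i = ℤS.solve-∀
    right : ∀ r → linearizationTerm L M (+ j) r ≈ 0#
    right r with r ℕ.<? j
    ... | yes r<j = linearizationTerm-low L M r<j
    ... | no r≮j  = linearizationTerm-wide L M (+ j) (ℕₚ.<-≤-trans (s≤s (ℕₚ.m≤m+n M d)) (ℕₚ.≮⇒≥ r≮j))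

  -- [n; L+j] [n; L-j] = Σ_r q^(r²-j²) [n; L-r] [M+r; 2r] [2r; r+j], where n = L+M
  linearization : ∀ L M j → B (+ L) (+ M) j j ≈ sumTo (suc L) (linearizationTerm L M j)
  linearization L M (+ j)    = linearization-ℕ L M j
  linearization L M -[1+ j ] = trans (B-neg (+ L) (+ M) (+ suc j) (+ suc j)) (trans (linearization-ℕ L M (suc j))
    (sumTo-cong (suc L) λ r _ → *-congˡ (*-congˡ (*-congˡ
      (Gℤ-sym (2 ℕ.* r) { + r ℤ.+ + suc j} { + r ℤ.+ -[1+ j ]} (≡.trans (i (+ r) (+ suc j)) (≡.sym (ℤₚ.pos-* 2 r))))))))
    where
    i : ∀ r j → r ℤ.+ j ℤ.+ (r ℤ.+ ℤ.- j) ≡ + 2 ℤ.* r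
    i = ℤS.solve-∀

  -- The alternating sum as a function of (a,b)

  B-sum : ℕ → ℕ → ℕ → ℤ → ℤ → Carrier
  B-sum K a b L M = sumℤ± K (λ j → sgn j * (E (+ a ℤ.* + b ℤ.* (j ℤ.* j) ℤ.+ T j) * B L M (+ a ℤ.* j) (+ b ℤ.* j)))

  -- In the linearized product q^(-j²) cancels q^(ab j²), so the sum over j becomes the alternating
  -- sum of [2r; r+j]. Only r = 0 survives; L ≤ K makes the range wide enough for every other r.
  B-sum-1-1 : ∀ K L M → L ℕ.≤ K → B-sum K 1 1 (+ L) (+ M) ≈ G (L ℕ.+ M) L
  B-sum-1-1 K L M L≤K = begin
    B-sum K 1 1 (+ L) (+ M)
      ≈⟨ sumℤ±-cong K expand ⟩
    sumℤ± K (λ j → sumTo (suc L) (λ r → P r * h r j))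
      ≈⟨ sumℤ±-swap K (suc L) _ ⟩
    sumTo (suc L) (λ r → sumℤ± K (λ j → P r * h r j))
      ≈⟨ sumTo-cong (suc L) (λ r _ → sym (sumℤ±-*ˡ K (P r) (h r))) ⟩
    sumTo (suc L) (λ r → P r * sumℤ± K (h r))
      ≈⟨ sumTo-suc L _ ⟩
    P 0 * sumℤ± K (h 0) + sumTo L (λ r → P (suc r) * sumℤ± K (h (suc r)))
      ≈⟨ +-cong (*-cong P-0 (h-0 K)) (sumTo-0 L λ r r<L → x*0≈0 _ (alternating-sum-vanishes r K (ℕₚ.≤-trans r<L L≤K))) ⟩
    G (L ℕ.+ M) L * 1# + 0#
      ≈⟨ trans (+-identityʳ _) (*-identityʳ _) ⟩
    G (L ℕ.+ M) L ∎
    where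
    P : ℕ → Carrier
    P r = E (+ r ℤ.* + r) * (Gℤ (L ℕ.+ M) (+ L ℤ.- + r) * G (M ℕ.+ r) (2 ℕ.* r))
    h : ℕ → ℤ → Carrier
    h r j = sgn j * (E (T j) * Gℤ (2 ℕ.* r) (+ r ℤ.+ j))
    expand : ∀ j → sgn j * (E (+ 1 ℤ.* + 1 ℤ.* (j ℤ.* j) ℤ.+ T j) * B (+ L) (+ M) (+ 1 ℤ.* j) (+ 1 ℤ.* j))
                   ≈ sumTo (suc L) (λ r → P r * h r j)
    expand j = begin
      sgn j * (e * B (+ L) (+ M) (+ 1 ℤ.* j) (+ 1 ℤ.* j))
        ≈⟨ *-congˡ (*-congˡ (trans (reflexive (cong (λ x → B (+ L) (+ M) x x) (ℤₚ.*-identityˡ j))) (linearization L M j))) ⟩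
      sgn j * (e * sumTo (suc L) (linearizationTerm L M j))
        ≈⟨ *-assoc _ _ _ ⟨
      (sgn j * e) * sumTo (suc L) (linearizationTerm L M j)
        ≈⟨ sumTo-*ˡ (suc L) _ _ ⟩
      sumTo (suc L) (λ r → (sgn j * e) * linearizationTerm L M j r)
        ≈⟨ sumTo-cong (suc L) (λ r _ → trans (group _ _ _ _ _ _) (trans (*-congʳ (trans (sym (E-+ _ _)) (E-* (i j (T j) (+ r))))) (regroup _ _ _ _ _ _))) ⟩
      sumTo (suc L) (λ r → P r * h r j) ∎
      where
      e = E (+ 1 ℤ.* + 1 ℤ.* (j ℤ.* j) ℤ.+ T j)
      group : ∀ s e x a b c → (s * e) * (x * (a * (b * c))) ≈ (e * x) * (s * (a * (b * c)))
      group = solve 6 (λ s e x a b c → (s :* e) :* (x :* (a :* (b :* c))) := (e :* x) :* (s :* (a :* (b :* c)))) refl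
      regroup : ∀ s e x a b c → (e * x) * (s * (a * (b * c))) ≈ (e * (a * b)) * (s * (x * c))
      regroup = solve 6 (λ s e x a b c → (e :* x) :* (s :* (a :* (b :* c))) := (e :* (a :* b)) :* (s :* (x :* c))) refl
      i : ∀ j t r → + 1 ℤ.* + 1 ℤ.* (j ℤ.* j) ℤ.+ t ℤ.+ (r ℤ.* r ℤ.- j ℤ.* j) ≡ r ℤ.* r ℤ.+ t
      i = ℤS.solve-∀
    P-0 : P 0 ≈ G (L ℕ.+ M) L
    P-0 = trans (*-cong E-0 (trans (*-identityʳ _) (reflexive (cong (Gℤ (L ℕ.+ M)) (ℤₚ.+-identityʳ (+ L)))))) (*-identityˡ _)
    h-0 : ∀ K → sumℤ± K (h 0) ≈ 1#
    h-0 zero    = trans (sumℤ±-zero (h 0)) (trans (*-identityˡ _) (trans (*-identityʳ _) E-0))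
    h-0 (suc K) = trans (sumℤ±-suc K (h 0)) (trans (+-cong (h-0 K) (trans (+-cong (x*0≈0 _ (zeroʳ _)) (x*0≈0 _ (zeroʳ _))) (+-identityˡ _))) (+-identityʳ _))

  B-sum-swap : ∀ K a b L M → B-sum K a b L M ≈ B-sum K b a M L
  B-sum-swap K a b L M = sumℤ±-cong K λ j → *-congˡ (*-cong
    (E-≡ (cong (λ x → x ℤ.* (j ℤ.* j) ℤ.+ T j) (ℤₚ.*-comm (+ a) (+ b)))) (B-swap L M (+ a ℤ.* j) (+ b ℤ.* j)))

  -- The transform acts termwise in j; its factor q^(b² j²) turns ab into (a+b) b and leaves sign
  -- and T j alone.
  B-sum-burge : ∀ K a b L M →
    sumTo (suc L) (λ i → E (+ i ℤ.* + i) * (Q (+ 2 ℤ.* + L ℤ.+ + M ℤ.- + i) (+ 2 ℤ.* + L) * B-sum K a b (+ L ℤ.- + i) (+ i)))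
      ≈ B-sum K (a ℕ.+ b) b (+ L) (+ M)
  B-sum-burge K a b L M = begin
    sumTo (suc L) (λ i → p i * (q i * B-sum K a b (+ L ℤ.- + i) (+ i)))
      ≈⟨ sumTo-cong (suc L) (λ i _ → trans (sym (*-assoc _ _ _)) (trans (sumℤ±-*ˡ K _ _) (sumℤ±-cong K λ j → group _ _ _ _ _))) ⟩
    sumTo (suc L) (λ i → sumℤ± K (λ j → s j * burgeTerm L M (+ a ℤ.* j) (+ b ℤ.* j) i))
      ≈⟨ sumℤ±-swap K (suc L) _ ⟨
    sumℤ± K (λ j → sumTo (suc L) (λ i → s j * burgeTerm L M (+ a ℤ.* j) (+ b ℤ.* j) i))
      ≈⟨ sumℤ±-cong K (λ j → trans (sym (sumTo-*ˡ (suc L) (s j) _)) (trans (*-congˡ (burge-ℤ L M a b j)) (collect j))) ⟩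
    B-sum K (a ℕ.+ b) b (+ L) (+ M) ∎
    where
    p q : ℕ → Carrier
    p i = E (+ i ℤ.* + i)
    q i = Q (+ 2 ℤ.* + L ℤ.+ + M ℤ.- + i) (+ 2 ℤ.* + L)
    s : ℤ → Carrier
    s j = sgn j * E (+ a ℤ.* + b ℤ.* (j ℤ.* j) ℤ.+ T j)
    group : ∀ p q s e x → (p * q) * (s * (e * x)) ≈ (s * e) * (p * (q * x))
    group = solve 5 (λ p q s e x → (p :* q) :* (s :* (e :* x)) := (s :* e) :* (p :* (q :* x))) refl
    assoc₄ : ∀ s e f x → (s * e) * (f * x) ≈ s * ((e * f) * x)
    assoc₄ = solve 4 (λ s e f x → (s :* e) :* (f :* x) := s :* ((e :* f) :* x)) refl
    collect : ∀ j → s j * (E (+ b ℤ.* + b ℤ.* (j ℤ.* j)) * B (+ L) (+ M) ((+ a ℤ.+ + b) ℤ.* j) (+ b ℤ.* j)) ≈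
      sgn j * (E (+ (a ℕ.+ b) ℤ.* + b ℤ.* (j ℤ.* j) ℤ.+ T j) * B (+ L) (+ M) (+ (a ℕ.+ b) ℤ.* j) (+ b ℤ.* j))
    collect j = trans (assoc₄ _ _ _ _) (*-congˡ (*-congʳ (sym (E-* (i (+ a) (+ b) (j ℤ.* j) (T j))))))
      where
      i : ∀ a b x t → (a ℤ.+ b) ℤ.* b ℤ.* x ℤ.+ t ≡ (a ℤ.* b ℤ.* x ℤ.+ t) ℤ.+ b ℤ.* b ℤ.* x
      i = ℤS.solve-∀

  -- Iterating the Burge transform

  -- The arguments x, y stand for L+M, L; true is the move (a,b) ↦ (a+b,a), false is (a,b) ↦ (a+b,b).

  stepExponent : Bool → ℕ → ℕ → ℤ
  stepExponent true  y z = + z ℤ.* + z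
  stepExponent false y z = (+ y ℤ.- + z) ℤ.* (+ y ℤ.- + z)

  stepBinomial : Bool → ℕ → ℕ → ℕ → Carrier
  stepBinomial true  x y z = Q (+ x ℤ.+ + y ℤ.- + z) (+ 2 ℤ.* + y)
  stepBinomial false x y z = Q (+ x ℤ.+ + z) (+ 2 ℤ.* + y)

  -- In both moves z is the next L and y the next L+M. The Burge index is z for the true move,
  -- because of the swap, and y - z for the false one.
  iterated : ℕ → (ℕ → Bool) → ℕ → ℕ → ℕ → Carrier
  iterated R β zero    x y = Q (+ x) (+ y)
  iterated R β (suc d) x y =
    sumTo (suc R) (λ z → E (stepExponent (β 0) y z) * (stepBinomial (β 0) x y z * iterated R (β ∘ suc) d y z))

  -- This forces z ≤ y at every level, so the cut-off R has no effect once it reaches L. For the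
  -- true move the outer binomial vanishes for every z; for the false move it does so when z ≤ y,
  -- and otherwise the inner sum vanishes.
  iterated-above : ∀ R β d {x y} → x ℕ.< y → iterated R β d x y ≈ 0#
  iterated-above R β zero {x} x<y with e , ≡.refl ← ℕₚ.m≤n⇒∃[o]m+o≡n x<y = Q-above e (i (+ x) (+ e))
    where
    i : ∀ x e → + 1 ℤ.+ (x ℤ.+ e) ≡ x ℤ.+ (+ 1 ℤ.+ e)
    i = ℤS.solve-∀
  iterated-above R β (suc d) {x} {y} x<y with e , ≡.refl ← ℕₚ.m≤n⇒∃[o]m+o≡n x<y =
    sumTo-0 (suc R) λ z _ → x*0≈0 _ (vanish (β 0) z)
    where
    i : ∀ x e z → + 2 ℤ.* (+ 1 ℤ.+ (x ℤ.+ e)) ≡ (x ℤ.+ (+ 1 ℤ.+ (x ℤ.+ e)) ℤ.- z) ℤ.+ (+ 1 ℤ.+ (e ℤ.+ z))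
    i = ℤS.solve-∀
    vanish : ∀ t z → stepBinomial t x y z * iterated R (β ∘ suc) d y z ≈ 0#
    vanish true  z = 0*y≈0 _ (Q-above (e ℕ.+ z) (i (+ x) (+ e) (+ z)))
    vanish false z with z ℕ.≤? y
    ... | no z≰y = x*0≈0 _ (iterated-above R (β ∘ suc) d (ℕₚ.≰⇒> z≰y))
    ... | yes z≤y with u , z+u≡y ← ℕₚ.m≤n⇒∃[o]m+o≡n z≤y = 0*y≈0 _ (Q-above (e ℕ.+ u)
          (≡.trans (j₁ (+ y)) (≡.trans (cong (λ w → + y ℤ.+ w) (cong +_ (≡.sym z+u≡y))) (j₂ (+ x) (+ e) (+ z) (+ u)))))
      where
      j₁ : ∀ y → + 2 ℤ.* y ≡ y ℤ.+ y
      j₁ = ℤS.solve-∀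
      j₂ : ∀ x e z u → (+ 1 ℤ.+ (x ℤ.+ e)) ℤ.+ (z ℤ.+ u) ≡ (x ℤ.+ z) ℤ.+ (+ 1 ℤ.+ (e ℤ.+ u))
      j₂ = ℤS.solve-∀

  -- K occurs only on the right and R only on the left, so each side is constant in its own cut-off
  -- from L on.
  iterated≈B-sum : ∀ K R β d L M → L ℕ.≤ R → L ℕ.≤ K →
    iterated R β d (L ℕ.+ M) L ≈ B-sum K (proj₁ (pairOf β d)) (proj₂ (pairOf β d)) (+ L) (+ M)
  iterated≈B-sum K R β zero    L M L≤R L≤K = trans (Q-at (L ℕ.+ M) (+ L) ≡.refl ≡.refl) (sym (B-sum-1-1 K L M L≤K))
  iterated≈B-sum K R β (suc d) L M L≤R L≤K =
    trans (sumTo-trunc (s≤s L≤R) λ z L<z → x*0≈0 _ (x*0≈0 _ (iterated-above R (β ∘ suc) d L<z))) (step (β 0))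
    where
    a = proj₁ (pairOf (β ∘ suc) d)
    b = proj₂ (pairOf (β ∘ suc) d)
    tail : ∀ z {u} → z ℕ.+ u ≡ L → iterated R (β ∘ suc) d L z ≈ B-sum K a b (+ z) (+ u)
    tail z {u} ≡.refl = iterated≈B-sum K R (β ∘ suc) d z u (ℕₚ.≤-trans (ℕₚ.m≤m+n z u) L≤R) (ℕₚ.≤-trans (ℕₚ.m≤m+n z u) L≤K)
    term : Bool → ℕ → Carrier
    term t z = E (stepExponent t L z) * (stepBinomial t (L ℕ.+ M) L z * iterated R (β ∘ suc) d L z)
    step : ∀ t → sumTo (suc L) (term t) ≈ B-sum K (proj₁ (stepPair t (a , b))) (proj₂ (stepPair t (a , b))) (+ L) (+ M)
    step true = trans (sumTo-cong (suc L) λ z z<sL → rewrite-term z (ℕₚ.m≤n⇒∃[o]m+o≡n (ℕₚ.≤-pred z<sL))) (B-sum-burge K b a L M)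
      where
      rewrite-term : ∀ z → ∃ (λ u → z ℕ.+ u ≡ L) → term true z ≈
        E (+ z ℤ.* + z) * (Q (+ 2 ℤ.* + L ℤ.+ + M ℤ.- + z) (+ 2 ℤ.* + L) * B-sum K b a (+ L ℤ.- + z) (+ z))
      rewrite-term z (u , z+u≡L) = *-congˡ (*-cong (reflexive (cong (λ x → Q x (+ 2 ℤ.* + L)) (i₁ (+ L) (+ M) (+ z))))
        (trans (tail z z+u≡L) (trans (B-sum-swap K a b (+ z) (+ u))
          (reflexive (cong (λ x → B-sum K b a x (+ z)) (≡.trans (i₂ (+ z) (+ u)) (cong (λ x → + x ℤ.- + z) z+u≡L)))))))
        where
        i₁ : ∀ L M z → L ℤ.+ M ℤ.+ L ℤ.- z ≡ + 2 ℤ.* L ℤ.+ M ℤ.- z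
        i₁ = ℤS.solve-∀
        i₂ : ∀ z u → u ≡ z ℤ.+ u ℤ.- z
        i₂ = ℤS.solve-∀
    -- Reversal passes from the new L to the Burge index i = L - z.
    step false = trans (sumTo-reverse L (term false))
        (trans (sumTo-cong (suc L) λ z z<sL → rewrite-term z (ℕₚ.m≤n⇒∃[o]m+o≡n (ℕₚ.≤-pred z<sL))) (B-sum-burge K a b L M))
      where
      rewrite-term : ∀ z → ∃ (λ u → z ℕ.+ u ≡ L) → term false (L ℕ.∸ z) ≈
        E (+ z ℤ.* + z) * (Q (+ 2 ℤ.* + L ℤ.+ + M ℤ.- + z) (+ 2 ℤ.* + L) * B-sum K a b (+ L ℤ.- + z) (+ z))
      rewrite-term z (u , z+u≡L) =
        *-cong (E-≡ (≡.trans (cong₂ (λ x y → (+ x ℤ.- + y) ℤ.* (+ x ℤ.- + y)) (≡.sym z+u≡L) L∸z) (i₁ (+ z) (+ u))))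
          (*-cong (reflexive (cong (λ x → Q x (+ 2 ℤ.* + L)) (≡.trans (cong (λ x → + (L ℕ.+ M) ℤ.+ + x) L∸z)
                    (≡.trans (cong (λ x → + L ℤ.+ + M ℤ.+ x) L-z) (i₂ (+ L) (+ M) (+ z))))))
                  (trans (reflexive (cong (iterated R (β ∘ suc) d L) L∸z))
                  (trans (tail u (≡.trans (ℕₚ.+-comm u z) z+u≡L)) (reflexive (cong (λ x → B-sum K a b x (+ z)) L-z)))))
        where
        L∸z : L ℕ.∸ z ≡ u
        L∸z = ≡.trans (cong (ℕ._∸ z) (≡.sym z+u≡L)) (ℕₚ.m+n∸m≡n z u)
        i₁ : ∀ z u → (z ℤ.+ u ℤ.- u) ℤ.* (z ℤ.+ u ℤ.- u) ≡ z ℤ.* z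
        i₁ = ℤS.solve-∀
        i₂ : ∀ L M z → L ℤ.+ M ℤ.+ (L ℤ.- z) ≡ + 2 ℤ.* L ℤ.+ M ℤ.- z
        i₂ = ℤS.solve-∀
        i₃ : ∀ z u → u ≡ z ℤ.+ u ℤ.- z
        i₃ = ℤS.solve-∀
        L-z : + u ≡ + L ℤ.- + z
        L-z = ≡.trans (i₃ (+ z) (+ u)) (cong (λ x → + x ℤ.- + z) z+u≡L)

-- The ring of Laurent polynomials

infix 4 _≋_
-- Lists of monomials are not canonical: order, repetitions and zero coefficients are invisible to
-- `coeff`.
record _≋_ (p r : Poly) : Set where
  constructor coeffs
  field coeff-≡ : ∀ k → coeff p k ≡ coeff r k
open _≋_

≡⇒≋ : ∀ {p r} → p ≡ r → p ≋ r
≡⇒≋ ≡.refl = coeffs λ _ → ≡.refl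

≋-sym : ∀ {p r} → p ≋ r → r ≋ p
≋-sym h = coeffs λ k → ≡.sym (coeff-≡ h k)

≋-trans : ∀ {p r s} → p ≋ r → r ≋ s → p ≋ s
≋-trans g h = coeffs λ k → ≡.trans (coeff-≡ g k) (coeff-≡ h k)

coeff-⊕ : ∀ p r k → coeff (p ⊕ r) k ≡ coeff p k ℤ.+ coeff r k
coeff-⊕ []            r k = ≡.sym (ℤₚ.+-identityˡ _)
coeff-⊕ ((c , e) ∷ p) r k with does (e ℤ.≟ k)
... | true  = ≡.trans (cong (λ x → c ℤ.+ x) (coeff-⊕ p r k)) (≡.sym (ℤₚ.+-assoc c _ _))
... | false = coeff-⊕ p r k

infixr 7 _·_
_·_ : ℤ × ℤ → Poly → Poly
(c , e) · p = List.map (λ ce → (c ℤ.* proj₁ ce , e ℤ.+ proj₂ ce)) p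

+-cancel : ∀ e e′ → e′ ≡ e ℤ.+ e′ ℤ.- e
+-cancel = ℤS.solve-∀

-+-cancel : ∀ e k → e ℤ.+ (k ℤ.- e) ≡ k
-+-cancel = ℤS.solve-∀

coeff-· : ∀ c e p k → coeff ((c , e) · p) k ≡ c ℤ.* coeff p (k ℤ.- e)
coeff-· c e []              k = ≡.sym (ℤₚ.*-zeroʳ c)
coeff-· c e ((c′ , e′) ∷ p) k with e ℤ.+ e′ ℤ.≟ k
... | yes ≡.refl rewrite dec-true (e′ ℤ.≟ e ℤ.+ e′ ℤ.- e) (+-cancel e e′) =
  ≡.trans (cong (λ x → c ℤ.* c′ ℤ.+ x) (coeff-· c e p (e ℤ.+ e′))) (≡.sym (ℤₚ.*-distribˡ-+ c c′ _))
... | no e+e′≢k rewrite dec-false (e′ ℤ.≟ k ℤ.- e) (λ e′≡k-e → e+e′≢k (≡.trans (cong (λ x → e ℤ.+ x) e′≡k-e) (-+-cancel e k))) =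
  coeff-· c e p k

⊕-cong : ∀ {p p′ r r′} → p ≋ p′ → r ≋ r′ → p ⊕ r ≋ p′ ⊕ r′
⊕-cong {p} {p′} {r} {r′} g h = coeffs λ k →
  ≡.trans (coeff-⊕ p r k) (≡.trans (cong₂ ℤ._+_ (coeff-≡ g k) (coeff-≡ h k)) (≡.sym (coeff-⊕ p′ r′ k)))

⊕-comm : ∀ p r → p ⊕ r ≋ r ⊕ p
⊕-comm p r = coeffs λ k → ≡.trans (coeff-⊕ p r k) (≡.trans (ℤₚ.+-comm (coeff p k) _) (≡.sym (coeff-⊕ r p k)))

·-cong : ∀ x {p r} → p ≋ r → x · p ≋ x · r
·-cong (c , e) {p} {r} h = coeffs λ k →
  ≡.trans (coeff-· c e p k) (≡.trans (cong (λ y → c ℤ.* y) (coeff-≡ h (k ℤ.- e))) (≡.sym (coeff-· c e r k)))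

⊗-congˡ : ∀ p {r r′} → r ≋ r′ → p ⊗ r ≋ p ⊗ r′
⊗-congˡ []      h = ≡⇒≋ ≡.refl
⊗-congˡ (x ∷ p) {r} {r′} h = ⊕-cong {x · r} {x · r′} (·-cong x h) (⊗-congˡ p h)

-- The product is defined by recursion on its left factor; peeling a monomial off the right one is
-- what commutativity needs.
⊗-∷ʳ : ∀ r x p → r ⊗ (x ∷ p) ≋ x · r ⊕ r ⊗ p
⊗-∷ʳ []      x p = ≡⇒≋ ≡.refl
⊗-∷ʳ (y@(c , e) ∷ r) x@(c′ , e′) p = ≋-trans
  (⊕-cong {(c ℤ.* c′ , e ℤ.+ e′) ∷ y · p} (≡⇒≋ (cong (_∷ y · p) (cong₂ _,_ (ℤₚ.*-comm c c′) (ℤₚ.+-comm e e′)))) (⊗-∷ʳ r x p))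
  (⊕-cong {List.[ (c′ ℤ.* c , e′ ℤ.+ e) ]} (≡⇒≋ ≡.refl) interchange)
  where
  interchange : y · p ⊕ (x · r ⊕ r ⊗ p) ≋ x · r ⊕ (y · p ⊕ r ⊗ p)
  interchange = ≋-trans (≡⇒≋ (≡.sym (Listₚ.++-assoc (y · p) (x · r) (r ⊗ p))))
    (≋-trans (⊕-cong (⊕-comm (y · p) (x · r)) (≡⇒≋ ≡.refl)) (≡⇒≋ (Listₚ.++-assoc (x · r) (y · p) (r ⊗ p))))

⊗-zeroʳ : ∀ p → p ⊗ [] ≡ []
⊗-zeroʳ []      = ≡.refl
⊗-zeroʳ (x ∷ p) = ⊗-zeroʳ p

⊗-comm : ∀ p r → p ⊗ r ≋ r ⊗ p
⊗-comm []      r = ≡⇒≋ (≡.sym (⊗-zeroʳ r))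
⊗-comm (x ∷ p) r = ≋-trans (⊕-cong {x · r} (≡⇒≋ ≡.refl) (⊗-comm p r)) (≋-sym (⊗-∷ʳ r x p))

⊗-distribʳ : ∀ s p r → (p ⊕ r) ⊗ s ≡ p ⊗ s ⊕ r ⊗ s
⊗-distribʳ s p r = Listₚ.concatMap-++ (_· s) p r

·-⊗ : ∀ x p r → (x · p) ⊗ r ≡ x · (p ⊗ r)
·-⊗ x []      r = ≡.refl
·-⊗ x@(c , e) (y@(c′ , e′) ∷ p) r = ≡.trans
  (cong₂ _++_ (≡.trans (Listₚ.map-cong (λ ce → cong₂ _,_ (ℤₚ.*-assoc c c′ (proj₁ ce)) (ℤₚ.+-assoc e e′ (proj₂ ce))) r) (Listₚ.map-∘ r)) (·-⊗ x p r))
  (≡.sym (Listₚ.map-++ _ (y · r) (p ⊗ r)))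

⊗-assoc : ∀ p r s → (p ⊗ r) ⊗ s ≡ p ⊗ (r ⊗ s)
⊗-assoc []      r s = ≡.refl
⊗-assoc (x ∷ p) r s = ≡.trans (⊗-distribʳ s (x · r) (p ⊗ r)) (cong₂ _++_ (·-⊗ x r s) (⊗-assoc p r s))

⊗-identityˡ : ∀ p → oneP ⊗ p ≋ p
⊗-identityˡ p = coeffs λ k → ≡.trans (cong (λ r → coeff r k) (Listₚ.++-identityʳ ((+ 1 , + 0) · p)))
  (≡.trans (coeff-· (+ 1) (+ 0) p k) (≡.trans (ℤₚ.*-identityˡ _) (cong (coeff p) (ℤₚ.+-identityʳ k))))

⊝_ : Poly → Poly
⊝ p = (ℤ.-1ℤ , + 0) · p

coeff-⊝ : ∀ p k → coeff (⊝ p) k ≡ ℤ.- coeff p k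
coeff-⊝ p k = ≡.trans (coeff-· ℤ.-1ℤ (+ 0) p k) (≡.trans (ℤₚ.-1*i≡-i _) (cong (λ x → ℤ.- coeff p x) (ℤₚ.+-identityʳ k)))

⊝-inverseʳ : ∀ p → p ⊕ ⊝ p ≋ []
⊝-inverseʳ p = coeffs λ k → ≡.trans (coeff-⊕ p (⊝ p) k)
  (≡.trans (cong (λ x → coeff p k ℤ.+ x) (coeff-⊝ p k)) (ℤₚ.+-inverseʳ (coeff p k)))

Laurent : CommutativeRing 0ℓ 0ℓ
Laurent = record
  { Carrier = Poly
  ; _≈_     = _≋_
  ; _+_     = _⊕_
  ; _*_     = _⊗_
  ; -_      = ⊝_
  ; 0#      = zeroP
  ; 1#      = oneP
  ; isCommutativeRing = record
    { isRing = record
      { +-isAbelianGroup = record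
        { isGroup = record
          { isMonoid = record
            { isSemigroup = record
              { isMagma = record
                { isEquivalence = record { refl = ≡⇒≋ ≡.refl ; sym = ≋-sym ; trans = ≋-trans }
                ; ∙-cong = ⊕-cong
                }
              ; assoc = λ p r s → ≡⇒≋ (Listₚ.++-assoc p r s)
              }
            ; identity = (λ p → ≡⇒≋ ≡.refl) , λ p → ≡⇒≋ (Listₚ.++-identityʳ p)
            }
          ; inverse = (λ p → ≋-trans (⊕-comm (⊝ p) p) (⊝-inverseʳ p)) , ⊝-inverseʳ
          ; ⁻¹-cong = ·-cong (ℤ.-1ℤ , + 0)
          }
        ; comm = ⊕-comm
        }
      ; *-cong = λ {p} {p′} {r} {r′} g h →
          ≋-trans (⊗-congˡ p h) (≋-trans (⊗-comm p r′) (≋-trans (⊗-congˡ r′ g) (⊗-comm r′ p′)))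
      ; *-assoc = λ p r s → ≡⇒≋ (⊗-assoc p r s)
      ; *-identity = ⊗-identityˡ , λ p → ≋-trans (⊗-comm p oneP) (⊗-identityˡ p)
      ; distrib =
          (λ s p r → ≋-trans (⊗-comm s (p ⊕ r)) (≋-trans (≡⇒≋ (⊗-distribʳ s p r)) (⊕-cong (⊗-comm p s) (⊗-comm r s))))
        , (λ s p r → ≡⇒≋ (⊗-distribʳ s p r))
      }
    ; *-comm = ⊗-comm
    }
  }

q^ : Exponential Laurent
q^ = record { E = mono (+ 1) ; E-0 = ≡⇒≋ ≡.refl ; E-+ = λ i j → ≡⇒≋ ≡.refl }

open QSeries Laurent q^
open Exponential q^ using (E)
module ≋ = CommutativeRing Laurent

-- The given polynomials as elements of the Laurent ring

qbinℕ≋G : ∀ n m → qbinℕ n m ≋ G n m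
qbinℕ≋G n       zero    = ≋.refl
qbinℕ≋G zero    (suc m) = ≋.refl
qbinℕ≋G (suc n) (suc m) = ≋.+-cong {qbinℕ n m} (qbinℕ≋G n m) (⊗-congˡ (E (+ suc m)) (qbinℕ≋G n (suc m)))

qbin≋Q : ∀ n m → qbin n m ≋ Q n m
qbin≋Q (+ n) (+ m) with m ℕ.≤ᵇ n in eq
... | true  = ≋-trans (qbinℕ≋G n m) (≡⇒≋ (≡.sym (Q≡Gℤ n (+ m))))
... | false = ≋-sym (≋-trans (≡⇒≋ (Q≡Gℤ n (+ m)))
    (G-above {n} {m} (ℕₚ.≰⇒> λ m≤n → subst Bool.T eq (ℕₚ.≤⇒≤ᵇ m≤n))))
qbin≋Q (+ n)    -[1+ m ] = ≡⇒≋ (≡.sym (Q≡Gℤ n -[1+ m ]))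
qbin≋Q -[1+ n ] (+ m)    = ≡⇒≋ (≡.sym (Q-negative-top n (+ m)))
qbin≋Q -[1+ n ] -[1+ m ] = ≡⇒≋ (≡.sym (Q-negative-top n -[1+ m ]))

mono-sgn : ∀ n → mono (ℤ.-1ℤ ℤ.^ n) (+ 0) ≋ sgn (+ n)
mono-sgn zero    = ≋.refl
mono-sgn (suc n) = ≋.-‿cong (mono-sgn n)

mono-± : ∀ j e → mono (ℤ.-1ℤ ℤ.^ ℤ.∣ j ∣) e ≋ sgn j ⊗ E e
mono-± j e = ≋-trans
  (≡⇒≋ (cong₂ mono (≡.sym (ℤₚ.*-identityʳ _)) (≡.sym (ℤₚ.+-identityˡ e))))
  (≋.*-congʳ {E e} (sgn-abs j))
  where
  sgn-abs : ∀ j → mono (ℤ.-1ℤ ℤ.^ ℤ.∣ j ∣) (+ 0) ≋ sgn j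
  sgn-abs (+ n)    = mono-sgn n
  sgn-abs -[1+ n ] = mono-sgn (suc n)

-- The remainder equals 2(i - q), hence is even, and it is less than 2.
*2/2 : ∀ i → (i ℤ.* + 2) ℤ./ℕ 2 ≡ i
*2/2 i = decide r (ℤ÷.n%ℕd<d (i ℤ.* + 2) 2) (≡.trans (rearrange (+ r) q i (ℤ÷.a≡a%ℕn+[a/ℕn]*n (i ℤ.* + 2) 2)) ≡.refl)
  where
  r = (i ℤ.* + 2) ℤ.%ℕ 2
  q = (i ℤ.* + 2) ℤ./ℕ 2
  rearrange : ∀ r q i → i ℤ.* + 2 ≡ r ℤ.+ q ℤ.* + 2 → (i ℤ.- q) ℤ.* + 2 ≡ r
  rearrange r q i eq = ≡.trans (distrib i q) (≡.trans (cong (ℤ._- q ℤ.* + 2) eq) (cancel r (q ℤ.* + 2)))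
    where
    distrib : ∀ i q → (i ℤ.- q) ℤ.* + 2 ≡ i ℤ.* + 2 ℤ.- q ℤ.* + 2
    distrib = ℤS.solve-∀
    cancel : ∀ x y → x ℤ.+ y ℤ.- y ≡ x
    cancel = ℤS.solve-∀
  decide : ∀ r → r ℕ.< 2 → (i ℤ.- q) ℤ.* + 2 ≡ + r → q ≡ i
  decide zero    _ eq = ≡.sym (ℤₚ.i-j≡0⇒i≡j i q (ℤₚ.*-cancelʳ-≡ (i ℤ.- q) (+ 0) (+ 2) eq))
  decide (suc zero) _ eq = contradiction (≡.trans (≡.sym (ℤₚ.abs-* (i ℤ.- q) (+ 2))) (cong ℤ.∣_∣ eq)) (odd ℤ.∣ i ℤ.- q ∣)
    where
    odd : ∀ n → ¬ (n ℕ.* 2 ≡ 1)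
    odd (suc n) ()
  decide (suc (suc _)) (s≤s (s≤s ())) _

T*2 : ∀ j → T j ℤ.* + 2 ≡ j ℤ.* (j ℤ.+ + 1)
T*2 (+ n)    = triangular*2 n
  where
  triangular*2 : ∀ n → triangular n ℤ.* + 2 ≡ + n ℤ.* (+ n ℤ.+ + 1)
  triangular*2 zero    = ≡.refl
  triangular*2 (suc n) = ≡.trans (ℤₚ.*-distribʳ-+ (+ 2) (triangular n) (+ suc n))
    (≡.trans (cong (ℤ._+ + suc n ℤ.* + 2) (triangular*2 n)) (i (+ n)))
    where
    i : ∀ n → n ℤ.* (n ℤ.+ + 1) ℤ.+ (+ 1 ℤ.+ n) ℤ.* + 2 ≡ (+ 1 ℤ.+ n) ℤ.* (+ 1 ℤ.+ n ℤ.+ + 1)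
    i = ℤS.solve-∀
T*2 -[1+ n ] = ≡.trans (T*2 (+ n)) (i (+ n))
  where
  i : ∀ n → n ℤ.* (n ℤ.+ + 1) ≡ ℤ.- (+ 1 ℤ.+ n) ℤ.* (ℤ.- (+ 1 ℤ.+ n) ℤ.+ + 1)
  i = ℤS.solve-∀

lhs-exponent : ∀ a b j → (j ℤ.* (+ (2 ℕ.* a ℕ.* b ℕ.+ 1) ℤ.* j ℤ.+ + 1)) ℤ./ℕ 2 ≡ + a ℤ.* + b ℤ.* (j ℤ.* j) ℤ.+ T j
lhs-exponent a b j = ≡.trans (cong (ℤ._/ℕ 2) doubled) (*2/2 (+ a ℤ.* + b ℤ.* (j ℤ.* j) ℤ.+ T j))
  where
  coefficient : + (2 ℕ.* a ℕ.* b ℕ.+ 1) ≡ + 2 ℤ.* + a ℤ.* + b ℤ.+ + 1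
  coefficient = cong (ℤ._+ + 1) (≡.trans (ℤₚ.pos-* (2 ℕ.* a) b) (cong (ℤ._* + b) (ℤₚ.pos-* 2 a)))
  doubled : j ℤ.* (+ (2 ℕ.* a ℕ.* b ℕ.+ 1) ℤ.* j ℤ.+ + 1) ≡ (+ a ℤ.* + b ℤ.* (j ℤ.* j) ℤ.+ T j) ℤ.* + 2
  doubled = ≡.trans (cong (λ x → j ℤ.* (x ℤ.* j ℤ.+ + 1)) coefficient)
    (≡.trans (i (+ a) (+ b) j) (≡.trans (cong (λ x → + a ℤ.* + b ℤ.* (j ℤ.* j) ℤ.* + 2 ℤ.+ x) (≡.sym (T*2 j)))
      (≡.sym (ℤₚ.*-distribʳ-+ (+ 2) (+ a ℤ.* + b ℤ.* (j ℤ.* j)) (T j)))))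
    where
    i : ∀ a b j → j ℤ.* ((+ 2 ℤ.* a ℤ.* b ℤ.+ + 1) ℤ.* j ℤ.+ + 1) ≡ a ℤ.* b ℤ.* (j ℤ.* j) ℤ.* + 2 ℤ.+ j ℤ.* (j ℤ.+ + 1)
    i = ℤS.solve-∀

lhsTerm≋ : ∀ a b L M j →
  lhsTerm a b L M j ≋ sgn j ⊗ (E (+ a ℤ.* + b ℤ.* (j ℤ.* j) ℤ.+ T j) ⊗ B (+ L) (+ M) (+ a ℤ.* j) (+ b ℤ.* j))
lhsTerm≋ a b L M j = ≋-trans
  (≋.*-cong (≋-trans (≡⇒≋ (cong (mono _) (lhs-exponent a b j))) (mono-± j _)) (≋.*-cong (qbin≋Q _ _) (qbin≋Q _ _)))
  (≋.*-assoc (sgn j) _ _)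

sumP-applyUpTo : ∀ (f : ℕ → Poly) g n → sumP (map f (applyUpTo g n)) ≋ sumTo n (f ∘ g)
sumP-applyUpTo f g zero    = ≋-sym (sumTo-zero (f ∘ g))
sumP-applyUpTo f g (suc n) = ≋-trans (⊕-cong {f (g 0)} ≋.refl (sumP-applyUpTo f (g ∘ suc) n)) (≋-sym (sumTo-suc n (f ∘ g)))

lhsPartial≋B-sum : ∀ a b L M R → lhsPartial a b L M R ≋ B-sum R a b (+ L) (+ M)
lhsPartial≋B-sum a b L M R = ≋-trans (≡⇒≋ (cong sumP (≡.sym (Listₚ.map-∘ (upTo (suc (2 ℕ.* R)))))))
  (≋-trans (sumP-applyUpTo _ id (suc (2 ℕ.* R)))
  (≋-trans (sumTo-symmetric-range R (lhsTerm a b L M)) (sumℤ±-cong R (lhsTerm≋ a b L M))))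

weight : ∀ {d} → (ℕ → Bool) → ℕ → ℕ → Vec ℕ d → Poly
weight β x y []      = Q (+ x) (+ y)
weight β x y (z ∷ m) = E (stepExponent (β 0) y z) ⊗ (stepBinomial (β 0) x y z ⊗ weight (β ∘ suc) y z m)

sumP-*ˡ : ∀ {A : Set} p (f : A → Poly) xs → sumP (map (λ x → p ⊗ f x) xs) ≋ p ⊗ sumP (map f xs)
sumP-*ˡ p f []       = ≡⇒≋ (≡.sym (⊗-zeroʳ p))
sumP-*ˡ p f (x ∷ xs) = ≋-trans (⊕-cong {p ⊗ f x} ≋.refl (sumP-*ˡ p f xs)) (≋-sym (≋.distribˡ p (f x) _))

sumP-cong : ∀ {A : Set} {f g : A → Poly} xs → (∀ x → f x ≋ g x) → sumP (map f xs) ≋ sumP (map g xs)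
sumP-cong []       h = ≋.refl
sumP-cong (x ∷ xs) h = ⊕-cong (h x) (sumP-cong xs h)

sumP-concatMap : ∀ {A : Set} (f : A → Poly) (h : ℕ → List A) xs →
  sumP (map f (concatMap h xs)) ≡ sumP (map (λ x → sumP (map f (h x))) xs)
sumP-concatMap f h []       = ≡.refl
sumP-concatMap f h (x ∷ xs) = ≡.trans (cong sumP (Listₚ.map-++ f (h x) (concatMap h xs)))
  (≡.trans (≡.sym (Listₚ.concat-++ (map f (h x)) _)) (cong (sumP (map f (h x)) ++_) (sumP-concatMap f h xs)))

-- `box` runs through its first coordinate outermost, which is the nesting of `iterated`; the
-- factors of a slice that depend on z alone come out.
box-sum : ∀ R β d x y → sumP (map (weight β x y) (box d R)) ≋ iterated R β d x y
box-sum R β zero    x y = ≡⇒≋ (Listₚ.++-identityʳ (Q (+ x) (+ y)))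
box-sum R β (suc d) x y = ≋-trans (≡⇒≋ (sumP-concatMap (weight β x y) (λ z → map (z ∷_) (box d R)) (upTo (suc R))))
  (≋-trans (sumP-applyUpTo _ id (suc R)) (sumTo-cong (suc R) λ z _ → slice z))
  where
  slice : ∀ z → sumP (map (weight β x y) (map (z ∷_) (box d R))) ≋
    E (stepExponent (β 0) y z) ⊗ (stepBinomial (β 0) x y z ⊗ iterated R (β ∘ suc) d y z)
  slice z = ≋-trans (≡⇒≋ (cong sumP (≡.sym (Listₚ.map-∘ (box d R)))))
    (≋-trans (sumP-*ˡ (E (stepExponent (β 0) y z)) _ (box d R)) (⊗-congˡ (E (stepExponent (β 0) y z))
    (≋-trans (sumP-*ˡ (stepBinomial (β 0) x y z) (weight (β ∘ suc) y z) (box d R))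
             (⊗-congˡ (stepBinomial (β 0) x y z) (box-sum R (β ∘ suc) d y z)))))

exponent : ∀ {d} → (ℕ → Bool) → ℕ → Vec ℕ d → ℤ
exponent β y []      = + 0
exponent β y (z ∷ m) = stepExponent (β 0) y z ℤ.+ exponent (β ∘ suc) z m

binomials : ∀ {d} → (ℕ → Bool) → ℕ → ℕ → Vec ℕ d → Poly
binomials β x y []      = Q (+ x) (+ y)
binomials β x y (z ∷ m) = stepBinomial (β 0) x y z ⊗ binomials (β ∘ suc) y z m

weight≋ : ∀ {d} β x y (m : Vec ℕ d) → weight β x y m ≋ E (exponent β y m) ⊗ binomials β x y m
weight≋ β x y []      = ≋-sym (≋.*-identityˡ (Q (+ x) (+ y)))
weight≋ β x y (z ∷ m) = ≋-trans (⊗-congˡ e (⊗-congˡ b (weight≋ (β ∘ suc) y z m)))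
  (≋-trans (⊗-congˡ e (≋-trans (≋-sym (≋.*-assoc b e′ w)) (≋-trans (≋.*-congʳ {w} (≋.*-comm b e′)) (≋.*-assoc e′ b w))))
           (≋-sym (≋.*-assoc e e′ (b ⊗ w))))
  where
  e = E (stepExponent (β 0) y z)
  e′ = E (exponent (β ∘ suc) z m)
  b = stepBinomial (β 0) x y z
  w = binomials (β ∘ suc) y z m

-- The summands of F

Σᶠ : ∀ d → (Fin d → ℤ) → ℤ
Σᶠ d f = sumℤ (map f (allFin d))

map-allFin-suc : ∀ {A : Set} d (f : Fin (suc d) → A) → map f (allFin (suc d)) ≡ f Fin.zero ∷ map (f ∘ Fin.suc) (allFin d)
map-allFin-suc d f = cong (f Fin.zero ∷_) (≡.trans (Listₚ.map-tabulate Fin.suc f) (≡.sym (Listₚ.map-tabulate id (f ∘ Fin.suc))))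

Σᶠ-suc : ∀ d f → Σᶠ (suc d) f ≡ f Fin.zero ℤ.+ Σᶠ d (f ∘ Fin.suc)
Σᶠ-suc d f = cong sumℤ (map-allFin-suc d f)

Σᶠ-cong : ∀ d {f g} → (∀ i → f i ≡ g i) → Σᶠ d f ≡ Σᶠ d g
Σᶠ-cong d h = cong sumℤ (Listₚ.map-cong h (allFin d))

Σᶠ-0 : ∀ d → Σᶠ d (λ _ → + 0) ≡ + 0
Σᶠ-0 zero    = ≡.refl
Σᶠ-0 (suc d) = ≡.trans (Σᶠ-suc d (λ _ → + 0)) (≡.trans (ℤₚ.+-identityˡ _) (Σᶠ-0 d))

Σᶠ-+ : ∀ d f g → Σᶠ d (λ i → f i ℤ.+ g i) ≡ Σᶠ d f ℤ.+ Σᶠ d g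
Σᶠ-+ zero    f g = ≡.refl
Σᶠ-+ (suc d) f g = ≡.trans (Σᶠ-suc d (λ i → f i ℤ.+ g i)) (≡.trans (cong (λ x → f Fin.zero ℤ.+ g Fin.zero ℤ.+ x) (Σᶠ-+ d _ _))
  (≡.trans (i (f Fin.zero) (g Fin.zero) _ _) (cong₂ ℤ._+_ (≡.sym (Σᶠ-suc d f)) (≡.sym (Σᶠ-suc d g)))))
  where
  i : ∀ w x y z → w ℤ.+ x ℤ.+ (y ℤ.+ z) ≡ w ℤ.+ y ℤ.+ (x ℤ.+ z)
  i = ℤS.solve-∀

Σᶠ-*ˡ : ∀ d c f → Σᶠ d (λ i → c ℤ.* f i) ≡ c ℤ.* Σᶠ d f
Σᶠ-*ˡ zero    c f = ≡.sym (ℤₚ.*-zeroʳ c)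
Σᶠ-*ˡ (suc d) c f = ≡.trans (Σᶠ-suc d (λ i → c ℤ.* f i)) (≡.trans (cong (λ x → c ℤ.* f Fin.zero ℤ.+ x) (Σᶠ-*ˡ d c _))
  (≡.trans (≡.sym (ℤₚ.*-distribˡ-+ c _ _)) (cong (λ x → c ℤ.* x) (≡.sym (Σᶠ-suc d f)))))

-- entry p m i is the i-th entry of (p, m₁, …, m_d, 0, 0, …)
entry : ∀ {d} → ℤ → Vec ℕ d → ℕ → ℤ
entry p m       zero    = p
entry p []      (suc i) = + 0
entry p (x ∷ m) (suc i) = entry (+ x) m i

Σᶠ-δ : ∀ {d} (m : Vec ℕ d) p i → Σᶠ d (λ k → δ i (toℕ k) ℤ.* + lookup m k) ≡ entry p m (suc i)
Σᶠ-δ []              p i       = ≡.refl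
Σᶠ-δ {suc d} (x ∷ m) p zero    = ≡.trans (Σᶠ-suc d (λ k → δ 0 (toℕ k) ℤ.* + lookup (x ∷ m) k)) (≡.trans (cong₂ ℤ._+_ (ℤₚ.*-identityˡ (+ x)) (Σᶠ-0 d)) (ℤₚ.+-identityʳ (+ x)))
Σᶠ-δ {suc d} (x ∷ m) p (suc i) = ≡.trans (Σᶠ-suc d (λ k → δ (suc i) (toℕ k) ℤ.* + lookup (x ∷ m) k)) (≡.trans (ℤₚ.+-identityˡ _) (Σᶠ-δ m (+ x) i))

Σᶠ-δ-suc : ∀ {d} (m : Vec ℕ d) i → Σᶠ d (λ k → δ i (suc (toℕ k)) ℤ.* + lookup m k) ≡ entry (+ 0) m i
Σᶠ-δ-suc {d} m zero    = Σᶠ-0 d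
Σᶠ-δ-suc     m (suc i) = Σᶠ-δ m (+ 0) i

-- A row of C m in terms of p = m_(j-1), c = m_j, n = m_(j+1), on T and off T.
rowValue : Bool → ℤ → ℤ → ℤ → ℤ
rowValue true  p c n = c ℤ.- p ℤ.+ n
rowValue false p c n = + 2 ℤ.* c ℤ.- p ℤ.- n

-- p is the boundary value m_0. With p = 0 the row is that of C m; with p = L it is -n_j, since the
-- source term L only meets the first row.
row : ∀ {d} → Bool → ℤ → Vec ℕ d → ℕ → ℤ
row t p m i = rowValue t (entry p m i) (entry p m (suc i)) (entry p m (suc (suc i)))

Σᶠ-combination : ∀ {d} (m : Vec ℕ d) i x y z →
  Σᶠ d (λ k → x ℤ.* (δ i (toℕ k) ℤ.* + lookup m k) ℤ.+
              (y ℤ.* (δ i (suc (toℕ k)) ℤ.* + lookup m k) ℤ.+ z ℤ.* (δ (suc i) (toℕ k) ℤ.* + lookup m k)))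
    ≡ x ℤ.* entry (+ 0) m (suc i) ℤ.+ (y ℤ.* entry (+ 0) m i ℤ.+ z ℤ.* entry (+ 0) m (suc (suc i)))
Σᶠ-combination {d} m i x y z = ≡.trans (Σᶠ-+ d _ _) (cong₂ ℤ._+_ (≡.trans (Σᶠ-*ˡ d x _) (cong (λ w → x ℤ.* w) (Σᶠ-δ m (+ 0) i)))
  (≡.trans (Σᶠ-+ d _ _) (cong₂ ℤ._+_ (≡.trans (Σᶠ-*ˡ d y _) (cong (λ w → y ℤ.* w) (Σᶠ-δ-suc m i)))
                                     (≡.trans (Σᶠ-*ˡ d z _) (cong (λ w → z ℤ.* w) (Σᶠ-δ m (+ 0) (suc i)))))))

Cmat-row : ∀ cf {d} (m : Vec ℕ d) (i : Fin d) →
  Σᶠ d (λ k → Cmat cf (suc (toℕ i)) (suc (toℕ k)) ℤ.* + lookup m k) ≡ row (inT cf (suc (toℕ i))) (+ 0) m (toℕ i)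
Cmat-row cf {d} m i with inT cf (suc (toℕ i))
... | true = ≡.trans (Σᶠ-cong d λ k → e (δ (toℕ i) (toℕ k)) (δ (toℕ i) (suc (toℕ k))) (δ (suc (toℕ i)) (toℕ k)) (+ lookup m k))
    (≡.trans (Σᶠ-combination m (toℕ i) (+ 1) (ℤ.- + 1) (+ 1)) (r (entry (+ 0) m (suc (toℕ i))) (entry (+ 0) m (toℕ i)) (entry (+ 0) m (suc (suc (toℕ i))))))
  where
  e : ∀ c p n x → (+ 2 ℤ.* c ℤ.- (p ℤ.+ c ℤ.- n)) ℤ.* x ≡ + 1 ℤ.* (c ℤ.* x) ℤ.+ (ℤ.- + 1 ℤ.* (p ℤ.* x) ℤ.+ + 1 ℤ.* (n ℤ.* x))
  e = ℤS.solve-∀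
  r : ∀ c p n → + 1 ℤ.* c ℤ.+ (ℤ.- + 1 ℤ.* p ℤ.+ + 1 ℤ.* n) ≡ c ℤ.- p ℤ.+ n
  r = ℤS.solve-∀
... | false = ≡.trans (Σᶠ-cong d λ k → e (δ (toℕ i) (toℕ k)) (δ (toℕ i) (suc (toℕ k))) (δ (suc (toℕ i)) (toℕ k)) (+ lookup m k))
    (≡.trans (Σᶠ-combination m (toℕ i) (+ 2) (ℤ.- + 1) (ℤ.- + 1)) (r (entry (+ 0) m (suc (toℕ i))) (entry (+ 0) m (toℕ i)) (entry (+ 0) m (suc (suc (toℕ i))))))
  where
  e : ∀ c p n x → (+ 2 ℤ.* c ℤ.- (p ℤ.+ n)) ℤ.* x ≡ + 2 ℤ.* (c ℤ.* x) ℤ.+ (ℤ.- + 1 ℤ.* (p ℤ.* x) ℤ.+ ℤ.- + 1 ℤ.* (n ℤ.* x))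
  e = ℤS.solve-∀
  r : ∀ c p n → + 2 ℤ.* c ℤ.+ (ℤ.- + 1 ℤ.* p ℤ.+ ℤ.- + 1 ℤ.* n) ≡ + 2 ℤ.* c ℤ.- p ℤ.- n
  r = ℤS.solve-∀

quadratic : ∀ {d} → (ℕ → Bool) → ℤ → Vec ℕ d → ℤ
quadratic {d} γ p m = Σᶠ d (λ i → + lookup m i ℤ.* row (γ (toℕ i)) p m (toℕ i))

mCm≡quadratic : ∀ cf m → mCm cf m ≡ quadratic (inT cf ∘ suc) (+ 0) m
mCm≡quadratic cf m = Σᶠ-cong (dim cf) λ i → ≡.trans
  (Σᶠ-cong (dim cf) λ k → ℤₚ.*-assoc (+ lookup m i) (Cmat cf (suc (toℕ i)) (suc (toℕ k))) (+ lookup m k))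
  (≡.trans (Σᶠ-*ˡ (dim cf) (+ lookup m i) _) (cong (λ x → + lookup m i ℤ.* x) (Cmat-row cf m i)))

quadratic-∷ : ∀ {d} γ p z (m : Vec ℕ d) →
  quadratic γ p (z ∷ m) ≡ + z ℤ.* rowValue (γ 0) p (+ z) (entry (+ z) m 1) ℤ.+ quadratic (γ ∘ suc) (+ z) m
quadratic-∷ {d} γ p z m = Σᶠ-suc d (λ i → + lookup (z ∷ m) i ℤ.* row (γ (toℕ i)) p (z ∷ m) (toℕ i))

-- Only the first row sees p, with coefficient -1 on T and off T alike.
quadratic-shift : ∀ {d} γ p z (m : Vec ℕ d) → quadratic γ p (z ∷ m) ≡ quadratic γ (+ 0) (z ∷ m) ℤ.- + z ℤ.* p
quadratic-shift γ p z m = ≡.trans (quadratic-∷ γ p z m)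
  (≡.trans (shift (γ 0)) (cong (λ x → x ℤ.- + z ℤ.* p) (≡.sym (quadratic-∷ γ (+ 0) z m))))
  where
  n = entry (+ z) m 1
  q = quadratic (γ ∘ suc) (+ z) m
  shift : ∀ t → + z ℤ.* rowValue t p (+ z) n ℤ.+ q ≡ + z ℤ.* rowValue t (+ 0) (+ z) n ℤ.+ q ℤ.- + z ℤ.* p
  shift true  = i (+ z) p n q
    where
    i : ∀ z p n q → z ℤ.* (z ℤ.- p ℤ.+ n) ℤ.+ q ≡ z ℤ.* (z ℤ.- + 0 ℤ.+ n) ℤ.+ q ℤ.- z ℤ.* p
    i = ℤS.solve-∀
  shift false = i (+ z) p n q
    where
    i : ∀ z p n q → z ℤ.* (+ 2 ℤ.* z ℤ.- p ℤ.- n) ℤ.+ q ≡ z ℤ.* (+ 2 ℤ.* z ℤ.- + 0 ℤ.- n) ℤ.+ q ℤ.- z ℤ.* p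
    i = ℤS.solve-∀

-- The excess of the first square over z²: (y-z)² = z² + y(y-2z). It is the prefactor L(L-2m₁) in
-- the form of F for a ≥ 2b.
headCorrection : Bool → ℤ → ℤ → ℤ
headCorrection true  y z = + 0
headCorrection false y z = y ℤ.* (y ℤ.- + 2 ℤ.* z)

-- Completing squares: m_j² - 2 m_j m_(j+1) + m_(j+1)² off T, and m_(j+1)² on T, in agreement with the cross terms of mCm.
exponent≡quadratic : ∀ {d} β y z (m : Vec ℕ d) → β (suc d) ≡ true →
  exponent β y (z ∷ m) ≡ headCorrection (β 0) (+ y) (+ z) ℤ.+ quadratic (β ∘ suc) (+ 0) (z ∷ m)
exponent≡quadratic β y z []       last rewrite last = single (β 0)
  where
  single : ∀ t → stepExponent t y z ℤ.+ + 0 ≡ headCorrection t (+ y) (+ z) ℤ.+ (+ z ℤ.* (+ z ℤ.- + 0 ℤ.+ + 0) ℤ.+ + 0)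
  single true  = i (+ z)
    where
    i : ∀ z → z ℤ.* z ℤ.+ + 0 ≡ + 0 ℤ.+ (z ℤ.* (z ℤ.- + 0 ℤ.+ + 0) ℤ.+ + 0)
    i = ℤS.solve-∀
  single false = i (+ y) (+ z)
    where
    i : ∀ y z → (y ℤ.- z) ℤ.* (y ℤ.- z) ℤ.+ + 0 ≡ y ℤ.* (y ℤ.- + 2 ℤ.* z) ℤ.+ (z ℤ.* (z ℤ.- + 0 ℤ.+ + 0) ℤ.+ + 0)
    i = ℤS.solve-∀
exponent≡quadratic β y z (w ∷ m) last = ≡.trans
  (cong (λ x → stepExponent (β 0) y z ℤ.+ x) (exponent≡quadratic (β ∘ suc) z w m last))
  (≡.trans (combine (β 0) (β 1))
    (cong (λ x → headCorrection (β 0) (+ y) (+ z) ℤ.+ x)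
      -- The induction hypothesis has boundary value 0 in the tail, whereas `quadratic-∷` puts z
      -- there; the shift supplies the cross term -w z.
      (≡.sym (≡.trans (quadratic-∷ (β ∘ suc) (+ 0) z (w ∷ m)) (cong (λ x → + z ℤ.* rowValue (β 1) (+ 0) (+ z) (+ w) ℤ.+ x) (quadratic-shift (β ∘ suc ∘ suc) (+ z) w m))))))
  where
  q = quadratic (β ∘ suc ∘ suc) (+ 0) (w ∷ m)
  combine : ∀ s t → stepExponent s y z ℤ.+ (headCorrection t (+ z) (+ w) ℤ.+ q) ≡
    headCorrection s (+ y) (+ z) ℤ.+ (+ z ℤ.* rowValue t (+ 0) (+ z) (+ w) ℤ.+ (q ℤ.- + w ℤ.* + z))
  combine true  true  = i (+ z) (+ w) q
    where
    i : ∀ z w q → z ℤ.* z ℤ.+ (+ 0 ℤ.+ q) ≡ + 0 ℤ.+ (z ℤ.* (z ℤ.- + 0 ℤ.+ w) ℤ.+ (q ℤ.- w ℤ.* z))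
    i = ℤS.solve-∀
  combine true  false = i (+ z) (+ w) q
    where
    i : ∀ z w q → z ℤ.* z ℤ.+ (z ℤ.* (z ℤ.- + 2 ℤ.* w) ℤ.+ q) ≡ + 0 ℤ.+ (z ℤ.* (+ 2 ℤ.* z ℤ.- + 0 ℤ.- w) ℤ.+ (q ℤ.- w ℤ.* z))
    i = ℤS.solve-∀
  combine false true  = i (+ y) (+ z) (+ w) q
    where
    i : ∀ y z w q → (y ℤ.- z) ℤ.* (y ℤ.- z) ℤ.+ (+ 0 ℤ.+ q) ≡
      y ℤ.* (y ℤ.- + 2 ℤ.* z) ℤ.+ (z ℤ.* (z ℤ.- + 0 ℤ.+ w) ℤ.+ (q ℤ.- w ℤ.* z))
    i = ℤS.solve-∀
  combine false false = i (+ y) (+ z) (+ w) q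
    where
    i : ∀ y z w q → (y ℤ.- z) ℤ.* (y ℤ.- z) ℤ.+ (z ℤ.* (z ℤ.- + 2 ℤ.* w) ℤ.+ q) ≡
      y ℤ.* (y ℤ.- + 2 ℤ.* z) ℤ.+ (z ℤ.* (+ 2 ℤ.* z ℤ.- + 0 ℤ.- w) ℤ.+ (q ℤ.- w ℤ.* z))
    i = ℤS.solve-∀

-- This is τ, stated so that removing the first coordinate lowers d and i together.
weightIndex : (d i : ℕ) → ℤ
weightIndex d i = if suc i ℕ.≡ᵇ d then + 1 else + 2

factor : ∀ {d} → (ℕ → Bool) → ℤ → Vec ℕ d → Fin d → Poly
factor {d} γ p m i = qbin (weightIndex d (toℕ i) ℤ.* + lookup m i ℤ.- row (γ (toℕ i)) p m (toℕ i)) (weightIndex d (toℕ i) ℤ.* + lookup m i)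

-- For j < d the top 2m_j + n_j is m_(j-1) + m_j - m_(j+1) on T and m_(j-1) + m_(j+1) off T, as in
-- the binomial of the next move. In row d, where τ = 1, the top is m_(d-1), and [m_(d-1); m_d] is
-- the value at (1,1).
prod-factor : ∀ {d} γ x z (m : Vec ℕ d) → γ d ≡ true →
  prodP (map (factor γ (+ x) (z ∷ m)) (allFin (suc d))) ≋ binomials γ x z m
prod-factor γ x z [] last rewrite last = ≋-trans (≋.*-identityʳ _)
  (≋-trans (qbin≋Q _ _) (≡⇒≋ (cong₂ Q (i (+ x) (+ z)) (ℤₚ.*-identityˡ (+ z)))))
  where
  i : ∀ x z → + 1 ℤ.* z ℤ.- (z ℤ.- x ℤ.+ + 0) ≡ x
  i = ℤS.solve-∀
prod-factor {suc d} γ x z (w ∷ m) last = ≋-trans (≡⇒≋ (cong prodP (map-allFin-suc (suc d) (factor γ (+ x) (z ∷ w ∷ m)))))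
  (≋.*-cong (≋-trans (qbin≋Q _ _) (head (γ 0))) (prod-factor (γ ∘ suc) z w m last))
  where
  head : ∀ t → Q (+ 2 ℤ.* + z ℤ.- rowValue t (+ x) (+ z) (+ w)) (+ 2 ℤ.* + z) ≋ stepBinomial t x z w
  head true  = ≡⇒≋ (cong (λ n → Q n (+ 2 ℤ.* + z)) (i (+ x) (+ z) (+ w)))
    where
    i : ∀ x z w → + 2 ℤ.* z ℤ.- (z ℤ.- x ℤ.+ w) ≡ x ℤ.+ z ℤ.- w
    i = ℤS.solve-∀
  head false = ≡⇒≋ (cong (λ n → Q n (+ 2 ℤ.* + z)) (i (+ x) (+ z) (+ w)))
    where
    i : ∀ x z w → + 2 ℤ.* z ℤ.- (+ 2 ℤ.* z ℤ.- x ℤ.- w) ≡ x ℤ.+ w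
    i = ℤS.solve-∀

entry-suc : ∀ {d} p p′ (m : Vec ℕ d) i → entry p m (suc i) ≡ entry p′ m (suc i)
entry-suc p p′ []      i = ≡.refl
entry-suc p p′ (x ∷ m) i = ≡.refl

nj≡row : ∀ cf m L i → nj cf m L i ≡ ℤ.- row (inT cf (suc (toℕ i))) (+ L) m (toℕ i)
nj≡row cf m L i = ≡.trans (cong (λ x → + L ℤ.* δ (suc (toℕ i)) 1 ℤ.- x) (Cmat-row cf m i)) (absorb (inT cf (suc (toℕ i))) (toℕ i))
  where
  absorb : ∀ t i → + L ℤ.* δ (suc i) 1 ℤ.- row t (+ 0) m i ≡ ℤ.- row t (+ L) m i
  absorb t     (suc i) rewrite entry-suc (+ L) (+ 0) m i | entry-suc (+ L) (+ 0) m (suc i) | entry-suc (+ L) (+ 0) m (suc (suc i)) =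
    ≡.trans (cong (ℤ._- row t (+ 0) m (suc i)) (ℤₚ.*-zeroʳ (+ L))) (ℤₚ.+-identityˡ _)
  absorb true  zero    rewrite entry-suc (+ L) (+ 0) m 0 | entry-suc (+ L) (+ 0) m 1 = e (+ L) (entry (+ 0) m 1) (entry (+ 0) m 2)
    where
    e : ∀ L c n → L ℤ.* + 1 ℤ.- (c ℤ.- + 0 ℤ.+ n) ≡ ℤ.- (c ℤ.- L ℤ.+ n)
    e = ℤS.solve-∀
  absorb false zero    rewrite entry-suc (+ L) (+ 0) m 0 | entry-suc (+ L) (+ 0) m 1 = e (+ L) (entry (+ 0) m 1) (entry (+ 0) m 2)
    where
    e : ∀ L c n → L ℤ.* + 1 ℤ.- (+ 2 ℤ.* c ℤ.- + 0 ℤ.- n) ≡ ℤ.- (+ 2 ℤ.* c ℤ.- L ℤ.- n)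
    e = ℤS.solve-∀

prodTerm≡ : ∀ cf m L → prodTerm cf m L ≡ prodP (map (factor (inT cf ∘ suc) (+ L) m) (allFin (dim cf)))
prodTerm≡ cf m L = cong prodP (Listₚ.map-cong (λ i → cong (λ n → qbin (τ cf m i ℤ.* + lookup m i ℤ.+ n) (τ cf m i ℤ.* + lookup m i)) (nj≡row cf m L i)) (allFin (dim cf)))

-- Both forms of F under one flag, the first move: true for a ≤ 2b, false for a ≥ 2b.
summand : ∀ cf → Bool → ℕ → ℕ → Vec ℕ (dim cf) → Poly
summand cf true  L M m = mono (+ 1) (mCm cf m) ⊗ qbin (+ (2 ℕ.* L ℕ.+ M) ℤ.- + first m) (+ (2 ℕ.* L)) ⊗ prodTerm cf m L
summand cf false L M m =
  mono (+ 1) (+ L ℤ.* (+ L ℤ.- + (2 ℕ.* first m)) ℤ.+ mCm cf m) ⊗ qbin (+ (L ℕ.+ M ℕ.+ first m)) (+ (2 ℕ.* L)) ⊗ prodTerm cf m L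

-- The binomial with lower index 2L belongs to the first move; the product over j supplies the
-- remaining moves and the value at (1,1).
summand≋weight : ∀ t a as → All (1 ℕ.≤_) (suc a ∷ as) → ∀ L M m →
  summand (suc a ∷ as) t L M m ≋ weight (bits t (suc a ∷ as)) (L ℕ.+ M) L m
summand≋weight t a as pos L M (z ∷ m) = ≋-trans (pieces t exponent≡)
  (≋-trans (≋.*-assoc (E (exponent β L (z ∷ m))) (stepBinomial t (L ℕ.+ M) L z) (binomials (β ∘ suc) L z m)) (≋-sym (weight≋ β (L ℕ.+ M) L (z ∷ m))))
  where
  cf = suc a ∷ as
  β = bits t cf
  exponent≡ : exponent β L (z ∷ m) ≡ headCorrection t (+ L) (+ z) ℤ.+ mCm cf (z ∷ m)
  exponent≡ = ≡.trans (exponent≡quadratic β L z m (inT-dim cf pos)) (cong (λ x → headCorrection t (+ L) (+ z) ℤ.+ x) (≡.sym (mCm≡quadratic cf (z ∷ m))))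
  prodTerm≋ : prodTerm cf (z ∷ m) L ≋ binomials (β ∘ suc) L z m
  prodTerm≋ = ≋-trans (≡⇒≋ (prodTerm≡ cf (z ∷ m) L)) (prod-factor (inT cf ∘ suc) L z m (inT-dim cf pos))
  binomial : ∀ {n n′} → n ≡ n′ → qbin n (+ (2 ℕ.* L)) ≋ Q n′ (+ 2 ℤ.* + L)
  binomial ≡.refl = ≋-trans (qbin≋Q _ _) (≡⇒≋ (cong (Q _) (ℤₚ.pos-* 2 L)))
  assemble : ∀ {e e′} {b b′ c c′ : Poly} → e ≡ e′ → b ≋ b′ → c ≋ c′ → E e ⊗ b ⊗ c ≋ E e′ ⊗ b′ ⊗ c′
  assemble {e} {e′} {b} {b′} e≡e′ b≋b′ c≋c′ = ≋.*-cong {E e ⊗ b} {E e′ ⊗ b′} (≋.*-cong {E e} {E e′} (≡⇒≋ (cong E e≡e′)) b≋b′) c≋c′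
  pieces : ∀ t → exponent β L (z ∷ m) ≡ headCorrection t (+ L) (+ z) ℤ.+ mCm cf (z ∷ m) →
    summand cf t L M (z ∷ m) ≋ E (exponent β L (z ∷ m)) ⊗ stepBinomial t (L ℕ.+ M) L z ⊗ binomials (β ∘ suc) L z m
  pieces true  eq = assemble (≡.sym (≡.trans eq (ℤₚ.+-identityˡ (mCm cf (z ∷ m)))))
      (binomial (≡.trans (cong (λ x → x ℤ.+ + M ℤ.- + z) (ℤₚ.pos-* 2 L)) (i (+ L) (+ M) (+ z)))) prodTerm≋
    where
    i : ∀ L M z → + 2 ℤ.* L ℤ.+ M ℤ.- z ≡ L ℤ.+ M ℤ.+ L ℤ.- z
    i = ℤS.solve-∀
  pieces false eq = assemble (≡.sym (≡.trans eq (cong (λ x → + L ℤ.* (+ L ℤ.- x) ℤ.+ mCm cf (z ∷ m)) (≡.sym (ℤₚ.pos-* 2 z)))))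
      (binomial ≡.refl) prodTerm≋

-- Comparison of the partial sums

F-partial≋B-sum : ∀ t a b L M cf → All (1 ℕ.≤_) (toList cf) → stepPair t (cfVal cf) ≡ (a , b) → ∀ {K R} → L ℕ.≤ R → L ℕ.≤ K →
  sumP (map (summand cf t L M) (box (dim cf) R)) ≋ B-sum K a b (+ L) (+ M)
F-partial≋B-sum t a b L M (zero ∷ cs)   (() ∷ _)
F-partial≋B-sum t a b L M cf@(suc c ∷ cs) pos eq {K} {R} L≤R L≤K = ≋-trans (sumP-cong (box (dim cf) R) (summand≋weight t c cs pos L M))
  (≋-trans (box-sum R (bits t cf) (dim cf) (L ℕ.+ M) L)
  (≋-trans (iterated≈B-sum K R (bits t cf) (dim cf) L M L≤R L≤K)
  (≡⇒≋ (cong (λ p → B-sum K (proj₁ p) (proj₂ p) (+ L) (+ M)) (≡.trans (pairOf-bits t cf pos) eq)))))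

-- From R = L on, both partial sums are the same Laurent polynomial, so one threshold serves every
-- exponent k.
sameLimit : ∀ t a b L M cf → All (1 ℕ.≤_) (toList cf) → stepPair t (cfVal cf) ≡ (a , b) →
  SameLimit (lhsPartial a b L M) (λ R → sumP (map (summand cf t L M) (box (dim cf) R)))
sameLimit t a b L M cf pos eq k = coeff (B-sum L a b (+ L) (+ M)) k , L , λ R L≤R →
    -- The range of j is changed from R to L through the sum over m: it equals the alternating sum
    -- for K = R and for K = L.
    coeff-≡ (≋-trans (lhsPartial≋B-sum a b L M R) (≋-trans (≋-sym (F-sum L≤R L≤R)) (F-sum L≤R ℕₚ.≤-refl))) k
  , coeff-≡ (F-sum L≤R ℕₚ.≤-refl) k
  where
  open _≋_
  F-sum : ∀ {K R} → L ℕ.≤ R → L ℕ.≤ K → sumP (map (summand cf t L M) (box (dim cf) R)) ≋ B-sum K a b (+ L) (+ M)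
  F-sum = F-partial≋B-sum t a b L M cf pos eq

open import Data.Nat using (_≤_; _<_; _*_)

theorem3p3 : (L M a b : ℕ) → 1 ≤ b → b < a → Coprime a b →
    (cf : List⁺ ℕ) → All (λ x → 1 ≤ x) (toList cf) → IsCFOf cf (cfTarget a b) →
    (a ≤ 2 * b → SameLimit (lhsPartial a b L M) (Fle-partial cf L M))
    × (2 * b ≤ a → SameLimit (lhsPartial a b L M) (Fge-partial cf L M))
theorem3p3 L M a b _ b<a a⊥b cf pos isCF =
    (λ a≤2b → sameLimit true  a b L M cf pos (stepPair-cfVal a b b<a a⊥b cf isCF true  a≤2b))
  , (λ 2b≤a → sameLimit false a b L M cf pos (stepPair-cfVal a b b<a a⊥b cf isCF false 2b≤a))
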